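{- Let $G$ be a finite connected multigraph without loops on vertices $v_1,\ldots,v_n$, and let $(\mathbf{r},\mathbf{d})$ be an arithmetical structure on $G$ with $\mathbf{r}=(r_1,\ldots,r_n)$. Then \[ |\mathcal{K}(G;\mathbf{r})| = \sum_{\mathcal{T}} \prod_{i=1}^n r_i^{\deg_{\mathcal{T}}(v_i)-2}, \] where the sum ranges over all spanning trees $\mathcal{T}$ of $G$ (as subsets of the edge set of $G$) and $\deg_{\mathcal{T}}(v_i)$ is the degree of $v_i$ in $\mathcal{T}$.
   Context: The adjacency matrix $A$ of $G$ has entry $(i,j)$ equal to the number of edges between $v_i$ and $v_j$. An arithmetical structure on $G$ is a pair $(\mathbf{r},\mathbf{d})$ with $\mathbf{d}\in\mathbb{Z}_{\ge0}^n$ and $\mathbf{r}\in\mathbb{Z}_{>0}^n$ having entries with greatest common divisor $1$, such that $(\mathrm{diag}(\mathbf{d})-A)\mathbf{r}=\mathbf{0}$. Set $L(G,\mathbf{r})=\mathrm{diag}(\mathbf{d})-A$; it has rank $n-1$, and $\mathcal{K}(G;\mathbf{r})$ denotes the (finite) torsion subgroup of the cokernel $\mathbb{Z}^n/L(G,\mathbf{r})\mathbb{Z}^n$. -}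

module Defs where

open import Algebra.Bundles using (AbelianGroup)
open import Algebra.Morphism.Structures using (IsGroupMonomorphism)
import Algebra.Construct.Pointwise as Pointwise
import Algebra.Morphism.GroupMonomorphism as GroupMonomorphism
import Algebra.Properties.CommutativeMonoid.Mult as CommutativeMonoidMult
import Algebra.Properties.CommutativeMonoid.Sum as CommutativeMonoidSum
import Algebra.Properties.Group as GroupProperties
import Algebra.Properties.AbelianGroup as AbelianGroupProperties
import Algebra.Properties.Semiring.Sum as SemiringSum
open import Data.Bool.Base using (if_then_else_)
open import Data.Fin.Base using (Fin; zero; suc; toℕ; fromℕ<)
open import Data.Fin.Properties as Fin using (any?; all?; injective⇒≤; toℕ-fromℕ<)
open import Data.Fin.Subset using (Subset; inside; outside; _∈_)
open import Data.Fin.Subset.Properties using (_∈?_)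
open import Data.Integer.Base as ℤ using (ℤ; +_; -[1+_])
import Data.Integer.Properties as ℤₚ
open import Data.Integer.Tactic.RingSolver using (solve-∀)
open import Data.List.Base using (List; []; _∷_; _++_; map; length; filter; foldr; allFin; lookup)
open import Data.List.Relation.Unary.All as All using (All)
open import Data.List.Relation.Unary.AllPairs using ([]; _∷_)
open import Data.List.Relation.Unary.Any using (here; there)
open import Data.List.Membership.Propositional using () renaming (_∈_ to _∈ₗ_)
open import Data.List.Membership.Propositional.Properties using (∈-lookup)
open import Data.List.Relation.Unary.Unique.Propositional using (Unique)
import Data.List.Membership.DecPropositional as DecMembership
import Data.List.Relation.Unary.Unique.DecPropositional as DecUnique
open import Data.Nat.Base as ℕ using (ℕ; zero; suc; NonZero; _≤_; s≤s)
open import Data.Nat.GCD using (gcd)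
import Data.Nat.Properties as ℕₚ
open import Data.Product using (Σ; _×_; _,_; proj₁; proj₂; Σ-syntax; ∃-syntax)
open import Data.Product.Properties using (≡-dec)
open import Data.Rational.Base as ℚ using (ℚ; 0ℚ)
import Data.Rational.Properties as ℚₚ
open import Data.Sum using (_⊎_; inj₁; inj₂)
import Data.Vec.Base as Vec
import Data.Vec.Functional as Vector
open import Function.Base using (_∘_; id)
open import Function.Bundles using (Bijection)
open import Level using (Level; _⊔_; 0ℓ)
open import Relation.Binary.PropositionalEquality
open import Relation.Nullary using (¬_; Dec; yes; no; does; contradiction)
open import Relation.Nullary.Decidable using (_×-dec_; _⊎-dec_; ¬?; map′)

module _ {c ℓ : Level} (G : AbelianGroup c ℓ) where
  private
    module G = AbelianGroup G
  open CommutativeMonoidMult G.commutativeMonoid using ()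
    renaming (_×_ to _·_; ×-distrib-+ to ·-distrib; ×-assocˡ to ·-assoc; ×-congʳ to ·-congʳ; ×-congˡ to ·-congˡ)
  open GroupProperties G.group using (ε⁻¹≈ε)
  open AbelianGroupProperties G using (⁻¹-∙-comm)

  IsTorsion : G.Carrier → Set ℓ
  IsTorsion x = ∃[ k ] (NonZero k × k · x G.≈ G.ε)

  private
    ·-ε : ∀ k → k · G.ε G.≈ G.ε
    ·-ε zero    = G.refl
    ·-ε (suc k) = G.trans (G.identityˡ _) (·-ε k)

    ·-⁻¹ : ∀ k x → k · (x G.⁻¹) G.≈ (k · x) G.⁻¹
    ·-⁻¹ zero    x = G.sym ε⁻¹≈ε
    ·-⁻¹ (suc k) x = G.trans (G.∙-congˡ (·-⁻¹ k x)) (⁻¹-∙-comm x (k · x))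

    multiple : ∀ k l x → l · x G.≈ G.ε → (k ℕ.* l) · x G.≈ G.ε
    multiple k l x lx≈ε = G.trans (G.sym (·-assoc x k l)) (G.trans (·-congʳ k lx≈ε) (·-ε k))

  torsion-∙ : ∀ {x y} → IsTorsion x → IsTorsion y → IsTorsion (x G.∙ y)
  torsion-∙ {x} {y} (k , k≢0 , kx≈ε) (l , l≢0 , ly≈ε) =
    k ℕ.* l , ℕₚ.m*n≢0 k l {{k≢0}} {{l≢0}} ,
    G.trans (·-distrib x y (k ℕ.* l))
      (G.trans (G.∙-cong (G.trans (·-congˡ (ℕₚ.*-comm k l)) (multiple l k x kx≈ε))
                         (multiple k l y ly≈ε))
               (G.identityˡ _))

  torsion-ε : IsTorsion G.ε
  torsion-ε = 1 , _ , ·-ε 1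

  torsion-⁻¹ : ∀ {x} → IsTorsion x → IsTorsion (x G.⁻¹)
  torsion-⁻¹ {x} (k , k≢0 , kx≈ε) =
    k , k≢0 , G.trans (·-⁻¹ k x) (G.trans (G.⁻¹-cong kx≈ε) ε⁻¹≈ε)

  torsionSubgroup : AbelianGroup (c ⊔ ℓ) ℓ
  torsionSubgroup = record
    { Carrier        = Σ G.Carrier IsTorsion
    ; _≈_            = λ x y → proj₁ x G.≈ proj₁ y
    ; _∙_            = λ (x , p) (y , q) → x G.∙ y , torsion-∙ p q
    ; ε              = G.ε , torsion-ε
    ; _⁻¹            = λ (x , p) → x G.⁻¹ , torsion-⁻¹ p
    ; isAbelianGroup = GroupMonomorphism.isAbelianGroup proj₁-isMonomorphism G.isAbelianGroup
    }
    where
    proj₁-isMonomorphism : IsGroupMonomorphism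
      (record { Carrier = Σ G.Carrier IsTorsion
              ; _≈_     = λ x y → proj₁ x G.≈ proj₁ y
              ; _∙_     = λ (x , p) (y , q) → x G.∙ y , torsion-∙ p q
              ; ε       = G.ε , torsion-ε
              ; _⁻¹     = λ (x , p) → x G.⁻¹ , torsion-⁻¹ p })
      G.rawGroup proj₁
    proj₁-isMonomorphism = record
      { isGroupHomomorphism = record
        { isMonoidHomomorphism = record
          { isMagmaHomomorphism = record
            { isRelHomomorphism = record { cong = id }
            ; homo              = λ _ _ → G.refl }
          ; ε-homo = G.refl }
        ; ⁻¹-homo = λ _ → G.refl }
      ; injective = id }

HasOrder : ∀ {c ℓ} → AbelianGroup c ℓ → ℕ → Set (c ⊔ ℓ)
HasOrder G N = Bijection (setoid (Fin N)) (AbelianGroup.setoid G)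

open SemiringSum ℤₚ.+-*-semiring using (sum; sum-cong-≗; ∑-distrib-+; sum-replicate-zero)

Matrix : ℕ → ℕ → Set
Matrix m n = Fin m → Fin n → ℤ

infixr 7 _*ᵥ_

_*ᵥ_ : ∀ {m n} → Matrix m n → (Fin n → ℤ) → (Fin m → ℤ)
(M *ᵥ x) i = sum (λ j → M i j ℤ.* x j)

diag : ∀ {n} → (Fin n → ℤ) → Matrix n n
diag d i j = if does (i Fin.≟ j) then d i else ℤ.0ℤ

module _ {m n : ℕ} (M : Matrix m n) where

  *ᵥ-zero : ∀ i → (M *ᵥ λ _ → ℤ.0ℤ) i ≡ ℤ.0ℤ
  *ᵥ-zero i = trans (sum-cong-≗ (λ j → ℤₚ.*-zeroʳ (M i j))) (sum-replicate-zero n)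

  *ᵥ-+ : ∀ x y i → (M *ᵥ λ j → x j ℤ.+ y j) i ≡ (M *ᵥ x) i ℤ.+ (M *ᵥ y) i
  *ᵥ-+ x y i = trans (sum-cong-≗ (λ j → ℤₚ.*-distribˡ-+ (M i j) (x j) (y j)))
                     (∑-distrib-+ (λ j → M i j ℤ.* x j) (λ j → M i j ℤ.* y j))

  *ᵥ-neg : ∀ x i → (M *ᵥ λ j → ℤ.- x j) i ≡ ℤ.- (M *ᵥ x) i
  *ᵥ-neg x i = inverseˡ-unique ((M *ᵥ λ j → ℤ.- x j) i) ((M *ᵥ x) i)
    (trans (sym (*ᵥ-+ (λ j → ℤ.- x j) x i))
      (trans (sum-cong-≗ (λ j → cong (M i j ℤ.*_) (ℤₚ.+-inverseˡ (x j)))) (*ᵥ-zero i)))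
    where open GroupProperties (AbelianGroup.group ℤₚ.+-0-abelianGroup) using (inverseˡ-unique)

  infix 4 _≡_modImage

  record _≡_modImage (x y : Fin m → ℤ) : Set where
    constructor _,_
    field
      preimage   : Fin n → ℤ
      difference : ∀ i → x i ℤ.- y i ≡ (M *ᵥ preimage) i

  private
    _∼_ : (x y : Fin m → ℤ) → Set
    _∼_ = _≡_modImage

    module ℤᵐ = AbelianGroup (Pointwise.abelianGroup (Fin m) ℤₚ.+-0-abelianGroup)

    ≗⇒∼ : ∀ {x y} → x ≗ y → x ∼ y
    ≗⇒∼ {x} {y} x≗y = (λ _ → ℤ.0ℤ) , λ i →
      trans (ℤₚ.i≡j⇒i-j≡0 (x≗y i)) (sym (*ᵥ-zero i))

    ∼-sym : ∀ {x y} → x ∼ y → y ∼ x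
    ∼-sym {x} {y} (u , p) = (λ j → ℤ.- u j) , λ i →
      trans (flip (x i) (y i)) (trans (cong ℤ.-_ (p i)) (sym (*ᵥ-neg u i)))
      where
      flip : ∀ a b → b ℤ.- a ≡ ℤ.- (a ℤ.- b)
      flip = solve-∀

    ∼-trans : ∀ {x y z} → x ∼ y → y ∼ z → x ∼ z
    ∼-trans {x} {y} {z} (u , p) (v , q) = (λ j → u j ℤ.+ v j) , λ i →
      trans (split (x i) (y i) (z i)) (trans (cong₂ ℤ._+_ (p i) (q i)) (sym (*ᵥ-+ u v i)))
      where
      split : ∀ a b c → a ℤ.- c ≡ (a ℤ.- b) ℤ.+ (b ℤ.- c)
      split = solve-∀

    ∼-+ : ∀ {x y z w} → x ∼ y → z ∼ w → (x ℤᵐ.∙ z) ∼ (y ℤᵐ.∙ w)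
    ∼-+ {x} {y} {z} {w} (u , p) (v , q) = (λ j → u j ℤ.+ v j) , λ i →
      trans (swap (x i) (y i) (z i) (w i)) (trans (cong₂ ℤ._+_ (p i) (q i)) (sym (*ᵥ-+ u v i)))
      where
      swap : ∀ a b c d → (a ℤ.+ c) ℤ.- (b ℤ.+ d) ≡ (a ℤ.- b) ℤ.+ (c ℤ.- d)
      swap = solve-∀

    ∼-neg : ∀ {x y} → x ∼ y → (x ℤᵐ.⁻¹) ∼ (y ℤᵐ.⁻¹)
    ∼-neg {x} {y} (u , p) = (λ j → ℤ.- u j) , λ i →
      trans (swap (x i) (y i)) (trans (cong ℤ.-_ (p i)) (sym (*ᵥ-neg u i)))
      where
      swap : ∀ a b → ℤ.- a ℤ.- ℤ.- b ≡ ℤ.- (a ℤ.- b)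
      swap = solve-∀

  cokernel : AbelianGroup 0ℓ 0ℓ
  cokernel = record
    { Carrier        = Fin m → ℤ
    ; _≈_            = _≡_modImage
    ; _∙_            = ℤᵐ._∙_
    ; ε              = ℤᵐ.ε
    ; _⁻¹            = ℤᵐ._⁻¹
    ; isAbelianGroup = record
      { isGroup = record
        { isMonoid = record
          { isSemigroup = record
            { isMagma = record
              { isEquivalence = record
                { refl = ≗⇒∼ (λ _ → refl) ; sym = ∼-sym ; trans = ∼-trans }
              ; ∙-cong = ∼-+ }
            ; assoc = λ x y z → ≗⇒∼ (ℤᵐ.assoc x y z) }
          ; identity = (λ x → ≗⇒∼ (ℤᵐ.identityˡ x)) , (λ x → ≗⇒∼ (ℤᵐ.identityʳ x)) }
        ; inverse = (λ x → ≗⇒∼ (ℤᵐ.inverseˡ x)) , (λ x → ≗⇒∼ (ℤᵐ.inverseʳ x))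
        ; ⁻¹-cong = ∼-neg }
      ; comm = λ x y → ≗⇒∼ (ℤᵐ.comm x y) }
    }

-- The order of the two components of `ends e` carries no meaning: every
-- notion below refers to `ends` only through the symmetric relation `Joins`.
record Multigraph (n : ℕ) : Set where
  field
    #edges   : ℕ
    ends     : Fin #edges → Fin n × Fin n
    loopless : ∀ e → proj₁ (ends e) ≢ proj₂ (ends e)

module _ {n : ℕ} (G : Multigraph n) where
  open Multigraph G

  Joins : Fin #edges → Fin n → Fin n → Set
  Joins e u v = ends e ≡ (u , v) ⊎ ends e ≡ (v , u)

  joins? : ∀ e u v → Dec (Joins e u v)
  joins? e u v = (ends e ≟ (u , v)) ⊎-dec (ends e ≟ (v , u))
    where _≟_ = ≡-dec Fin._≟_ Fin._≟_

  Incident : Fin #edges → Fin n → Set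
  Incident e v = ∃[ w ] Joins e v w

  incident? : ∀ e v → Dec (Incident e v)
  incident? e v = any? (joins? e v)

  adjacency : Fin n → Fin n → ℕ
  adjacency u v = length (filter (λ e → joins? e u v) (allFin #edges))

  -- There are no loops, so counting incident edges once each is correct.
  degree : Subset #edges → Fin n → ℕ
  degree T v = length (filter (λ e → (e ∈? T) ×-dec incident? e v) (allFin #edges))

  data Walk (T : Subset #edges) : Fin n → Fin n → Set where
    []   : ∀ {u} → Walk T u u
    step : ∀ {u v w} (e : Fin #edges) → e ∈ T → Joins e u v → Walk T v w → Walk T u w

  edges : ∀ {T u w} → Walk T u w → List (Fin #edges)
  edges []             = []
  edges (step e _ _ c) = e ∷ edges c

  -- All vertices visited by the walk except its final one, so that the
  -- vertices of a closed walk are listed without repeating the base point.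
  vertices : ∀ {T u w} → Walk T u w → List (Fin n)
  vertices []                   = []
  vertices (step {u = u} _ _ _ c) = u ∷ vertices c

  -- A set T of edges stands for the spanning subgraph (V , T).  In the
  -- presence of an arithmetical structure n is positive, since the empty
  -- family has greatest common divisor 0.
  Connected : Subset #edges → Set
  Connected T = ∀ u v → Walk T u v

  -- Two parallel edges form a cycle of length two; traversing one edge back
  -- and forth does not, which is why edges must be distinct too.
  IsCycle : ∀ {T u} → Walk T u u → Set
  IsCycle c = edges c ≢ [] × Unique (edges c) × Unique (vertices c)

  Acyclic : Subset #edges → Set
  Acyclic T = ∀ {u} (c : Walk T u u) → ¬ IsCycle c

  IsSpanningTree : Subset #edges → Set
  IsSpanningTree T = Connected T × Acyclic T

lookup-injective : ∀ {A : Set} {xs : List A} → Unique xs →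
                   ∀ {i j} → lookup xs i ≡ lookup xs j → i ≡ j
lookup-injective (_ ∷ _)  {zero}  {zero}  _  = refl
lookup-injective {xs = _ ∷ xs} (x∉ ∷ _) {zero}  {suc j} eq =
  contradiction eq (All.lookup x∉ (∈-lookup {xs = xs} j))
lookup-injective {xs = _ ∷ xs} (x∉ ∷ _) {suc i} {zero}  eq =
  contradiction (sym eq) (All.lookup x∉ (∈-lookup {xs = xs} i))
lookup-injective (_ ∷ xs!) {suc i} {suc j} eq = cong suc (lookup-injective xs! eq)

unique⇒length≤ : ∀ {n} {xs : List (Fin n)} → Unique xs → length xs ≤ n
unique⇒length≤ xs! = injective⇒≤ (lookup-injective xs!)

module _ {n : ℕ} (G : Multigraph n) where
  open Multigraph G

  walk-of-length? : ∀ {T} k u w {P : List (Fin #edges) → List (Fin n) → Set} →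
                    (∀ es vs → Dec (P es vs)) →
                    Dec (Σ[ c ∈ Walk G T u w ] (length (vertices G c) ≡ k × P (edges G c) (vertices G c)))
  walk-of-length? zero u w {P} P? with u Fin.≟ w
  ... | no u≢w = no λ { ([] , _) → u≢w refl ; (step _ _ _ _ , () , _) }
  ... | yes refl = map′ (λ p → [] , refl , p) from (P? [] [])
    where
    from : Σ[ c ∈ Walk G _ u u ] (length (vertices G c) ≡ 0 × P (edges G c) (vertices G c)) → P [] []
    from ([] , _ , p) = p
    from (step _ _ _ _ , () , _)
  walk-of-length? {T} (suc k) u w P? = map′
    (λ (e , v , e∈T , j , c , ≡k , p) → step e e∈T j c , cong suc ≡k , p)
    (λ { ([] , () , _)
       ; (step e e∈T j c , ≡k , p) → e , _ , e∈T , j , c , ℕₚ.suc-injective ≡k , p })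
    (any? λ e → any? λ v →
      (e ∈? T) ×-dec joins? G e u v ×-dec walk-of-length? k v w (λ es vs → P? (e ∷ es) (u ∷ vs)))

  -- Walks without repeated vertices have length at most n, so they can be
  -- searched exhaustively.
  walk? : ∀ {T} u w {P : List (Fin #edges) → List (Fin n) → Set} →
          (∀ es vs → Dec (P es vs)) → (∀ {es vs} → P es vs → Unique vs) →
          Dec (Σ[ c ∈ Walk G T u w ] P (edges G c) (vertices G c))
  walk? u w P? P⇒! = map′
    (λ (_ , c , _ , p) → c , p)
    (λ (c , p) → let len< = s≤s (unique⇒length≤ (P⇒! p)) in
      fromℕ< len< , c , sym (toℕ-fromℕ< len<) , p)
    (any? λ (k : Fin (suc n)) → walk-of-length? (toℕ k) u w P?)

  truncate : ∀ {T v w} (c : Walk G T v w) → Unique (vertices G c) → ∀ {u} → u ∈ₗ vertices G c →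
             Σ[ c ∈ Walk G T u w ] Unique (vertices G c)
  truncate c@(step _ _ _ _) c!       (here refl) = c , c!
  truncate (step _ _ _ c)   (_ ∷ c!) (there u∈c) = truncate c c! u∈c

  simplify : ∀ {T u w} → Walk G T u w → Σ[ c ∈ Walk G T u w ] Unique (vertices G c)
  simplify [] = [] , []
  simplify (step {u} e e∈T j c) with simplify c
  ... | c′ , c′! with DecMembership._∈?_ Fin._≟_ u (vertices G c′)
  ...   | yes u∈c′ = truncate c′ c′! u∈c′
  ...   | no  u∉c′ = step e e∈T j c′ , All.tabulate (λ v∈c′ u≡v → u∉c′ (subst (_∈ₗ _) (sym u≡v) v∈c′)) ∷ c′!

  connected? : ∀ T → Dec (Connected G T)
  connected? T = all? λ u → all? λ v → map′ proj₁ simplify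
    (walk? u v (λ _ vs → DecUnique.unique? Fin._≟_ vs) id)

  acyclic? : ∀ T → Dec (Acyclic G T)
  acyclic? T = map′ (λ ¬cycle {u} c cyc → ¬cycle (u , c , cyc)) (λ ac (_ , c , cyc) → ac c cyc)
    (¬? (any? λ u → walk? u u
      (λ es vs → ¬? (null? es) ×-dec DecUnique.unique? Fin._≟_ es ×-dec DecUnique.unique? Fin._≟_ vs)
      (λ (_ , _ , vs!) → vs!)))
    where
    null? : ∀ {A : Set} (xs : List A) → Dec (xs ≡ [])
    null? []      = yes refl
    null? (_ ∷ _) = no λ ()

  isSpanningTree? : ∀ T → Dec (IsSpanningTree G T)
  isSpanningTree? T = connected? T ×-dec acyclic? T

allSubsets : ∀ m → List (Subset m)
allSubsets zero    = Vec.[] ∷ []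
allSubsets (suc m) = map (outside Vec.∷_) (allSubsets m) ++ map (inside Vec.∷_) (allSubsets m)

spanningTrees : ∀ {n} (G : Multigraph n) → List (Subset (Multigraph.#edges G))
spanningTrees G = filter (isSpanningTree? G) (allSubsets (Multigraph.#edges G))

arithmeticalLaplacian : ∀ {n} → Multigraph n → (d : Fin n → ℕ) → Matrix n n
arithmeticalLaplacian G d i j = diag (+_ ∘ d) i j ℤ.- + adjacency G i j

record ArithmeticalStructure {n : ℕ} (G : Multigraph n) : Set where
  field
    r        : Fin n → ℕ
    d        : Fin n → ℕ
    r≢0      : ∀ i → NonZero (r i)
    gcd≡1    : Vector.foldr gcd 0 r ≡ 1
    balanced : ∀ i → (arithmeticalLaplacian G d *ᵥ (+_ ∘ r)) i ≡ ℤ.0ℤ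

-- d is determined by r, so the group depends on S only through r.
criticalGroup : ∀ {n} (G : Multigraph n) → ArithmeticalStructure G → AbelianGroup 0ℓ 0ℓ
criticalGroup G S = torsionSubgroup (cokernel (arithmeticalLaplacian G (ArithmeticalStructure.d S)))

infixr 8 _^ᶻ_

_^ᶻ_ : (b : ℕ) .{{_ : NonZero b}} → ℤ → ℚ
b ^ᶻ (+ k)    = + (b ℕ.^ k) ℚ./ 1
b ^ᶻ -[1+ k ] = ℚ._/_ (+ 1) (b ℕ.^ suc k) {{ℕₚ.m^n≢0 b (suc k)}}

sumℚ : List ℚ → ℚ
sumℚ = foldr ℚ._+_ 0ℚ

open CommutativeMonoidSum ℚₚ.*-1-commutativeMonoid using () renaming (sum to product) public

module _ {n : ℕ} (G : Multigraph n) (S : ArithmeticalStructure G) where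
  open ArithmeticalStructure S

  treeWeight : Subset (Multigraph.#edges G) → ℚ
  treeWeight T = product λ i → _^ᶻ_ (r i) {{r≢0 i}} (+ degree G T i ℤ.- + 2)

{-# OPTIONS --safe #-}
-- Choose v with r · v = 1 and put N = L + v vᵀ.  Then |det N| is the order of
-- the critical group, since coker N is r^⊥ / im L and Euclidean column operations
-- compute the order of coker N.  Scaling rows and columns by r turns N into the
-- Laplacian of G with edge weights r_u r_v plus w wᵀ, where w_i = r_i v_i has
-- sum 1; so (∏ r)² det N is the weighted number of spanning trees by deletion and
-- contraction, an edge contributing a rank one summand to the Laplacian.
-- Dividing the weight ∏_i r_i ^ deg_T(i) of a tree by (∏ r)² gives its summand.
module Submission where

open import Defs
open import Algebra.Bundles using (AbelianGroup)
import Algebra.Properties.CommutativeMonoid.Mult as CommutativeMonoidMult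
import Algebra.Properties.CommutativeMonoid.Sum as CommutativeMonoidSum
import Algebra.Properties.Semiring.Sum as SemiringSum
open import Data.Bool.Base using (true; false; if_then_else_; _∧_)
open import Data.Fin.Base using (Fin; zero; suc; toℕ; fromℕ<; punchIn; punchOut; combine; remQuot)
open import Data.Fin.Properties using (_≟_; suc-injective; toℕ<n; toℕ-fromℕ<; toℕ-injective; punchInᵢ≢i; punchIn-injective; punchIn-punchOut; remQuot-combine; combine-remQuot)
open import Data.Fin.Subset using (Subset; inside; outside; _∈_; _∉_; _⊆_; ⊤; ⁅_⁆) renaming (_-_ to _∖_; ∣_∣ to size)
open import Data.Fin.Subset.Properties using (_∈?_; nonempty?; x∈⁅x⁆; x∈⁅y⁆⇒x≡y; x∈p⇒∣p-x∣<∣p∣; x∈p∧x≢y⇒x∈p-y; p─q⊆p; p─q─q≡p─q)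
open import Data.Integer.Base as ℤ using (ℤ; +_; -[1+_]; -_; _+_; _*_; _-_; 0ℤ; 1ℤ; ∣_∣; ≢-nonZero)
import Data.Integer.DivMod as ℤ
import Data.Integer.Properties as ℤₚ
open import Data.Integer.Tactic.RingSolver using (solve-∀)
open import Data.List.Base using (List; []; _∷_; map; _++_; length; filter; tabulate; allFin)
open import Data.List.Membership.Propositional using () renaming (_∈_ to _∈ₗ_; _∉_ to _∉ₗ_)
open import Data.List.Membership.Propositional.Properties using (∈-allFin)
open import Data.List.Properties using (filter-≐; map-++; map-∘; map-cong)
open import Data.List.Relation.Unary.All as All using (_∷_)
open import Data.List.Relation.Unary.AllPairs using ([]; _∷_)
open import Data.List.Relation.Unary.Any using (here; there)
open import Data.List.Relation.Unary.Unique.Propositional using (Unique)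
import Data.List.Relation.Unary.Unique.DecPropositional as DecUnique
open import Data.Nat.Base as ℕ using (ℕ; zero; suc; _<_; NonZero)
open import Data.Nat.Coprimality using (1-coprimeTo) renaming (sym to coprime-sym)
open import Data.Nat.GCD using (gcd; gcd-GCD; module Bézout)
open import Data.Nat.Induction using (<-wellFounded)
import Data.Nat.ListAction as List
open import Data.Nat.ListAction.Properties using (sum-++)
import Data.Nat.Properties as ℕₚ
open import Data.Product using (Σ-syntax; _×_; _,_; proj₁; proj₂; ∃-syntax)
open import Data.Rational.Base as ℚ using (ℚ; mkℚ; _/_; 1ℚ; toℚᵘ)
import Data.Rational.Properties as ℚₚ
import Data.Rational.Unnormalised.Base as ℚᵘ
import Data.Rational.Unnormalised.Properties as ℚᵘₚ
open import Data.Sum.Base using (_⊎_; inj₁; inj₂; swap)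
open import Data.Vec.Base using ([]; _∷_; here; there)
import Data.Vec.Functional as Vector
open import Function.Base using (_∘_; id)
open import Function.Bundles using (_⇔_; mk⇔)
open import Induction.WellFounded using (Acc; acc)
open import Relation.Binary.PropositionalEquality
open import Relation.Nullary using (¬_; Dec; yes; no; does; contradiction)
open import Relation.Nullary.Decidable as Dec using (dec-true; dec-false; map′; _×-dec_; _⊎-dec_; does-⇔)

open SemiringSum ℤₚ.+-*-semiring using (sum; sum-cong-≗; ∑-distrib-+; sum-replicate-zero; ∑-comm; sum-remove; *-distribˡ-sum)
open CommutativeMonoidSum ℤₚ.*-1-commutativeMonoid using () renaming (sum to ∏; sum-remove to ∏-remove)
open CommutativeMonoidSum ℕₚ.+-0-commutativeMonoid using () renaming (sum to sumℕ)
open CommutativeMonoidSum ℕₚ.*-1-commutativeMonoid using ()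
  renaming (sum to ∏ℕ; ∑-distrib-+ to ∏ℕ-distrib-*; ∑-comm to ∏ℕ-comm; sum-cong-≗ to ∏ℕ-cong;
            sum-remove to ∏ℕ-remove; sum-replicate-zero to ∏ℕ-replicate-1)
open CommutativeMonoidSum ℚₚ.*-1-commutativeMonoid using ()
  renaming (∑-distrib-+ to product-distrib-*; sum-cong-≗ to product-cong)
open ≡-Reasoning

-- Determinants by Laplace expansion along the first column

-- The obstacle is that `L` is singular and its cokernel infinite. Since `r · v = 1`, the class of
-- `v` spans a free complement of the torsion, so adding `v vᵀ` kills exactly the infinite part and
-- turns the order into a determinant. On the tree side the same rank one term takes over the role
-- of the customary deleted row and column: contraction replaces `w` by a vector with the same sum,
-- so the induction needs no chosen root. The weights `r_u r_v` are those for which `L r = 0`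
-- becomes the statement that all rows of the scaled matrix sum to zero, as in an ordinary
-- Laplacian. The order has to be given as a bijection, hence by explicit representatives, and these
-- are built from `det N ≢ 0`. That fact comes back from the combinatorial side: connectedness makes
-- the tree sum positive.

sgn : ∀ {n} → Fin n → ℤ
sgn zero    = 1ℤ
sgn (suc i) = - sgn i

sgn² : ∀ {n} (i : Fin n) → sgn i * sgn i ≡ 1ℤ
sgn² zero    = refl
sgn² (suc i) = trans (neg² (sgn i)) (sgn² i)
  where
  neg² : ∀ s → - s * - s ≡ s * s
  neg² = solve-∀

_ᵀ : ∀ {m n} → Matrix m n → Matrix n m
(A ᵀ) i j = A j i

minor : ∀ {m n} → Matrix (suc m) (suc n) → Fin (suc m) → Fin (suc n) → Matrix m n
minor A p q i j = A (punchIn p i) (punchIn q j)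

det : ∀ {n} → Matrix n n → ℤ
det {zero}  A = 1ℤ
det {suc n} A = sum λ i → sgn i * A i zero * det (minor A i zero)

infix 4 _≋_

_≋_ : ∀ {m n} → Matrix m n → Matrix m n → Set
A ≋ B = ∀ i j → A i j ≡ B i j

det-cong : ∀ {n} {A B : Matrix n n} → A ≋ B → det A ≡ det B
det-cong {zero}  A≋B = refl
det-cong {suc n} A≋B = sum-cong-≗ λ i →
  cong₂ _*_ (cong (sgn i *_) (A≋B i zero)) (det-cong λ k l → A≋B (punchIn i k) (suc l))

sum-≡0 : ∀ {n} {f : Fin n → ℤ} → (∀ i → f i ≡ 0ℤ) → sum f ≡ 0ℤ
sum-≡0 {n} f≡0 = trans (sum-cong-≗ f≡0) (sum-replicate-zero n)

sum-neg : ∀ {n} (f : Fin n → ℤ) → sum (λ i → - f i) ≡ - sum f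
sum-neg f = trans (sum-cong-≗ λ i → sym (ℤₚ.-1*i≡-i (f i)))
  (trans (sym (*-distribˡ-sum (- 1ℤ) f)) (ℤₚ.-1*i≡-i (sum f)))

sum-sum-*ˡ : ∀ {m n} (a : Fin m → ℤ) (b : Fin m → Fin n → ℤ) →
             sum (λ i → a i * sum (b i)) ≡ sum (λ i → sum λ j → a i * b i j)
sum-sum-*ˡ a b = sum-cong-≗ λ i → *-distribˡ-sum (a i) (b i)

corner : ∀ {n} → Matrix (suc n) (suc n) → ℤ
corner A = 1ℤ * A zero zero * det (minor A zero zero)

-- A term of Cauchy's expansion of a bordered determinant: one entry from the rest of column 0, one
-- from the rest of row 0, and the minor that omits both rows and both columns.
border : ∀ {n} → Matrix (suc (suc n)) (suc (suc n)) → Fin (suc n) → Fin (suc n) → ℤ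
border A i j = (- sgn i) * A (suc i) zero *
  (sgn j * A zero (suc j) * det (minor (minor A (suc i) zero) zero j))

TransposeInvariant : ℕ → Set
TransposeInvariant n = (A : Matrix n n) → det (A ᵀ) ≡ det A

-- By induction, the minors in the terms i ≥ 1 of the first-column expansion
-- can be expanded along their first row, which makes the formula symmetric.
det-borderExpansion : ∀ {n} → TransposeInvariant n → TransposeInvariant (suc n) →
               (A : Matrix (suc (suc n)) (suc (suc n))) →
               det A ≡ corner A + (sum λ i → sum λ j → border A i j)
det-borderExpansion ihₙ ihₙ₊₁ A = cong (λ s → corner A + s) (trans
  (sum-cong-≗ λ i → cong ((- sgn i) * A (suc i) zero *_)
    (trans (sym (ihₙ₊₁ (minor A (suc i) zero)))
           (sum-cong-≗ λ j → cong (sgn j * A zero (suc j) *_)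
             (ihₙ (minor (minor A (suc i) zero) zero j)))))
  (sum-sum-*ˡ (λ i → (- sgn i) * A (suc i) zero)
    (λ i j → sgn j * A zero (suc j) * det (minor (minor A (suc i) zero) zero j))))

corner-ᵀ : ∀ {n} → TransposeInvariant n → (A : Matrix (suc n) (suc n)) → corner (A ᵀ) ≡ corner A
corner-ᵀ ih A = cong (1ℤ * A zero zero *_) (ih (minor A zero zero))

-- The two double minors are transposes of each other by computation, because `punchIn (suc i)`
-- commutes with `suc`; only their determinants need the induction hypothesis.
border-ᵀ : ∀ {n} → TransposeInvariant n → (A : Matrix (suc (suc n)) (suc (suc n))) →
           ∀ i j → border (A ᵀ) i j ≡ border A j i
border-ᵀ ih A i j = trans
  (cong (λ d → (- sgn i) * A zero (suc i) * (sgn j * A (suc j) zero * d))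
    (ih (minor (minor A (suc j) zero) zero i)))
  (rearrange (sgn i) (A zero (suc i)) (sgn j) (A (suc j) zero) _)
  where
  rearrange : ∀ s a t b d → (- s) * a * (t * b * d) ≡ (- t) * b * (s * a * d)
  rearrange = solve-∀

detᵀ : ∀ {n} → TransposeInvariant n
detᵀ {zero}        A = refl
detᵀ {suc zero}    A = refl
detᵀ {suc (suc n)} A = begin
  det (A ᵀ)                                             ≡⟨ det-borderExpansion detᵀ detᵀ (A ᵀ) ⟩
  corner (A ᵀ) + (sum λ i → sum λ j → border (A ᵀ) i j) ≡⟨ cong₂ _+_ (corner-ᵀ detᵀ A) (∑-comm (border (A ᵀ))) ⟩
  corner A + (sum λ j → sum λ i → border (A ᵀ) i j)     ≡⟨ cong (λ s → corner A + s) (sum-cong-≗ λ j → sum-cong-≗ λ i → border-ᵀ detᵀ A i j) ⟩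
  corner A + (sum λ i → sum λ j → border A i j)         ≡⟨ sym (det-borderExpansion detᵀ detᵀ A) ⟩
  det A                                                 ∎

-- punchOut extended to equal arguments, where its value is junk
without : ∀ {n} → Fin (suc (suc n)) → Fin (suc (suc n)) → Fin (suc n)
without         zero    zero    = zero
without         zero    (suc j) = j
without         (suc i) zero    = zero
without {zero}  (suc i) (suc j) = zero
without {suc n} (suc i) (suc j) = suc (without i j)

without-punchIn : ∀ {n} (i : Fin (suc (suc n))) k → without i (punchIn i k) ≡ k
without-punchIn         zero    k       = refl
without-punchIn         (suc i) zero    = refl
without-punchIn {suc n} (suc i) (suc k) = cong suc (without-punchIn i k)

-- Deleting one of two indices lowers the position of the other exactly when the other is larger. So
-- just one of the two orders of deletion involves a shift, and the signs differ.
sgn-without : ∀ {n} (i j : Fin (suc (suc n))) → i ≢ j →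
              sgn i * sgn (without i j) ≡ - (sgn j * sgn (without j i))
sgn-without zero    zero    i≢j = contradiction refl i≢j
sgn-without zero    (suc j) i≢j = identity (sgn j)
  where
  identity : ∀ s → 1ℤ * s ≡ - ((- s) * 1ℤ)
  identity = solve-∀
sgn-without (suc i) zero    i≢j = identity (sgn i)
  where
  identity : ∀ s → (- s) * 1ℤ ≡ - (1ℤ * s)
  identity = solve-∀
sgn-without {zero}  (suc zero) (suc zero) i≢j = contradiction refl i≢j
sgn-without {suc n} (suc i) (suc j) i≢j =
  trans (neg* (sgn i) _) (trans (sgn-without i j (i≢j ∘ cong suc)) (cong -_ (sym (neg* (sgn j) _))))
  where
  neg* : ∀ s t → (- s) * (- t) ≡ s * t
  neg* = solve-∀

-- Both sides enumerate the complement of `i` and `j` in increasing order.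
punchIn-without : ∀ {n} (i j : Fin (suc (suc n))) → i ≢ j → ∀ k →
                  punchIn i (punchIn (without i j) k) ≡ punchIn j (punchIn (without j i) k)
punchIn-without zero    zero    i≢j k = contradiction refl i≢j
punchIn-without zero    (suc j) i≢j k = refl
punchIn-without (suc i) zero    i≢j k = refl
punchIn-without {zero}  (suc zero) (suc zero) i≢j k = contradiction refl i≢j
punchIn-without {suc n} (suc i) (suc j) i≢j zero    = refl
punchIn-without {suc n} (suc i) (suc j) i≢j (suc k) = cong suc (punchIn-without i j (i≢j ∘ cong suc) k)

-- Turns a sum over `i` and the indices remaining after `i` into a sum over a full square, where
-- `∑-comm` applies.
offDiagonal : ∀ {n} → (Fin n → Fin n → ℤ) → Fin n → Fin n → ℤ
offDiagonal f i j = if does (i ≟ j) then 0ℤ else f i j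

sum-offDiagonal : ∀ {n} (f : Fin (suc n) → Fin (suc n) → ℤ) i →
                  sum (λ k → f i (punchIn i k)) ≡ sum (offDiagonal f i)
sum-offDiagonal f i = sym (begin
  sum (offDiagonal f i)
    ≡⟨ sum-remove {i = i} (offDiagonal f i) ⟩
  offDiagonal f i i + sum (λ k → offDiagonal f i (punchIn i k))
    ≡⟨ cong₂ _+_ (cong (if_then 0ℤ else f i i) (dec-true (i ≟ i) refl))
                 (sum-cong-≗ λ k → cong (if_then 0ℤ else f i (punchIn i k))
                   (dec-false (i ≟ punchIn i k) (punchInᵢ≢i i k ∘ sym))) ⟩
  0ℤ + sum (λ k → f i (punchIn i k))
    ≡⟨ ℤₚ.+-identityˡ _ ⟩
  sum (λ k → f i (punchIn i k)) ∎)

offDiagonal-transfer : ∀ {n} (f g : Fin n → Fin n → ℤ) → (∀ i j → i ≢ j → f i j ≡ g j i) →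
                       ∀ i j → offDiagonal f i j ≡ offDiagonal g j i
offDiagonal-transfer f g f≡gᵀ i j with i ≟ j | j ≟ i
... | yes _   | yes _   = refl
... | yes i≡j | no j≢i  = contradiction (sym i≡j) j≢i
... | no i≢j  | yes j≡i = contradiction (sym j≡i) i≢j
... | no i≢j  | no _    = f≡gᵀ i j i≢j

laplaceTerm : ∀ {n} → Matrix (suc n) (suc n) → Fin (suc n) → Fin (suc n) → ℤ
laplaceTerm A q i = sgn i * sgn q * A i q * det (minor A i q)

-- The summand belonging to rows i and j of the expansion of det A along the
-- columns 0 and suc q.
pairTerm : ∀ {n} → Matrix (suc (suc n)) (suc (suc n)) → Fin (suc n) →
           Fin (suc (suc n)) → Fin (suc (suc n)) → ℤ
pairTerm A q i j = sgn i * A i zero * (sgn (without i j) * sgn q * A j (suc q) *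
  det (λ x y → A (punchIn i (punchIn (without i j) x)) (suc (punchIn q y))))

pairTerm-det : ∀ {n} (A : Matrix (suc (suc n)) (suc (suc n))) q i j → i ≢ j →
  det (λ x y → A (punchIn i (punchIn (without i j) x)) (suc (punchIn q y))) ≡
  det (λ x y → A (punchIn j (punchIn (without j i) x)) (suc (punchIn q y)))
pairTerm-det A q i j i≢j = det-cong λ x y → cong (λ k → A k _) (punchIn-without i j i≢j x)

mutual
  -- The recursion is well founded because column `suc q` of the matrix is column `q` of its minors,
  -- which are smaller.
  det-pair : ∀ {n} (A : Matrix (suc (suc n)) (suc (suc n))) q →
             det A ≡ sum λ i → sum (offDiagonal (pairTerm A q) i)
  det-pair A q = begin
    det A
      ≡⟨ sum-cong-≗ (λ i → cong (λ s → sgn i * A i zero * s) (det-laplace (minor A i zero) q)) ⟩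
    (sum λ i → sgn i * A i zero * sum (laplaceTerm (minor A i zero) q))
      ≡⟨ sum-sum-*ˡ (λ i → sgn i * A i zero) (λ i → laplaceTerm (minor A i zero) q) ⟩
    (sum λ i → sum λ k → sgn i * A i zero * laplaceTerm (minor A i zero) q k)
      ≡⟨ sum-cong-≗ (λ i → sum-cong-≗ λ k → cong (λ l → sgn i * A i zero *
           (sgn l * sgn q * A (punchIn i k) (suc q) *
            det (λ x y → A (punchIn i (punchIn l x)) (suc (punchIn q y)))))
           (sym (without-punchIn i k))) ⟩
    (sum λ i → sum λ k → pairTerm A q i (punchIn i k))
      ≡⟨ sum-cong-≗ (sum-offDiagonal (pairTerm A q)) ⟩
    (sum λ i → sum (offDiagonal (pairTerm A q) i)) ∎

  -- Expanding along column `suc q` and then column 0 meets the same ordered pairs of rows as the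
  -- opposite order. The sign lost by exchanging the two deletions cancels the sign in
  -- `sgn (suc q) = - sgn q`.
  det-laplace : ∀ {n} (A : Matrix (suc n) (suc n)) q → det A ≡ sum (laplaceTerm A q)
  det-laplace A zero = sum-cong-≗ λ i → cong (λ s → s * A i zero * det (minor A i zero)) (sym (ℤₚ.*-identityʳ (sgn i)))
  det-laplace {suc n} A (suc q) = sym (begin
    (sum λ j → sgn j * (- sgn q) * A j (suc q) * det (minor A j (suc q)))
      ≡⟨ sum-sum-*ˡ (λ j → sgn j * (- sgn q) * A j (suc q))
           (λ j k → sgn k * A (punchIn j k) zero * det (minor (minor A j (suc q)) k zero)) ⟩
    (sum λ j → sum λ k → sgn j * (- sgn q) * A j (suc q) *
       (sgn k * A (punchIn j k) zero * det (minor (minor A j (suc q)) k zero)))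
      ≡⟨ sum-cong-≗ (λ j → sum-cong-≗ λ k → cong (λ l → sgn j * (- sgn q) * A j (suc q) *
           (sgn l * A (punchIn j k) zero * det (λ x y → A (punchIn j (punchIn l x)) (suc (punchIn q y)))))
           (sym (without-punchIn j k))) ⟩
    (sum λ j → sum λ k → flipped j (punchIn j k))
      ≡⟨ sum-cong-≗ (sum-offDiagonal flipped) ⟩
    (sum λ j → sum λ i → offDiagonal flipped j i)
      ≡⟨ sum-cong-≗ (λ j → sum-cong-≗ λ i → offDiagonal-transfer flipped (pairTerm A q) flip j i) ⟩
    (sum λ j → sum λ i → offDiagonal (pairTerm A q) i j)
      ≡⟨ ∑-comm (λ j i → offDiagonal (pairTerm A q) i j) ⟩
    (sum λ i → sum λ j → offDiagonal (pairTerm A q) i j)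
      ≡⟨ sym (det-pair A q) ⟩
    det A ∎)
    where
    flipped : Fin (suc (suc n)) → Fin (suc (suc n)) → ℤ
    flipped j i = sgn j * (- sgn q) * A j (suc q) * (sgn (without j i) * A i zero *
      det (λ x y → A (punchIn j (punchIn (without j i) x)) (suc (punchIn q y))))

    left : ∀ s u a t b d → s * (- u) * a * (t * b * d) ≡ - (s * t) * (u * a * b * d)
    left = solve-∀

    right : ∀ s u a t b d → (s * t) * (u * a * b * d) ≡ s * b * (t * u * a * d)
    right = solve-∀

    flip : ∀ j i → j ≢ i → flipped j i ≡ pairTerm A q i j
    flip j i j≢i = begin
      flipped j i
        ≡⟨ left (sgn j) (sgn q) (A j (suc q)) (sgn (without j i)) (A i zero) _ ⟩
      - (sgn j * sgn (without j i)) * (sgn q * A j (suc q) * A i zero * _)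
        ≡⟨ cong₂ (λ s d → s * (sgn q * A j (suc q) * A i zero * d))
             (sym (sgn-without i j (j≢i ∘ sym))) (pairTerm-det A q j i j≢i) ⟩
      (sgn i * sgn (without i j)) * (sgn q * A j (suc q) * A i zero * _)
        ≡⟨ right (sgn i) (sgn q) (A j (suc q)) (sgn (without i j)) (A i zero) _ ⟩
      pairTerm A q i j ∎

x≡-x⇒x≡0 : ∀ x → x ≡ - x → x ≡ 0ℤ
x≡-x⇒x≡0 (+ zero) _ = refl

-- When column 0 is one of the two, exchanging the two chosen rows negates each pair term, so the
-- determinant is its own negative. Otherwise every minor of the first-column expansion still has
-- two equal columns.
det-equalColumns : ∀ {n} (A : Matrix n n) {p q} → p ≢ q → (∀ i → A i p ≡ A i q) → det A ≡ 0ℤ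
det-equalColumns {suc n} A {zero} {zero} p≢q eq = contradiction refl p≢q
det-equalColumns {suc (suc n)} A {suc p} {zero} p≢q eq = det-equalColumns A (p≢q ∘ sym) (sym ∘ eq)
det-equalColumns {suc n} A {suc p} {suc q} p≢q eq = sum-≡0 λ i → trans
  (cong (λ s → sgn i * A i zero * s) (det-equalColumns (minor A i zero) (p≢q ∘ cong suc) λ k → eq (punchIn i k)))
  (ℤₚ.*-zeroʳ (sgn i * A i zero))
det-equalColumns {suc (suc n)} A {zero} {suc q} p≢q eq = x≡-x⇒x≡0 _ (begin
  det A                                       ≡⟨ det-pair A q ⟩
  (sum λ i → sum λ j → offDiagonal P i j)     ≡⟨ sum-cong-≗ (λ i → sum-cong-≗ λ j → negated i j) ⟩
  (sum λ i → sum λ j → - offDiagonal P j i)   ≡⟨ sum-cong-≗ (λ i → sum-neg (λ j → offDiagonal P j i)) ⟩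
  (sum λ i → - sum λ j → offDiagonal P j i)   ≡⟨ sum-neg (λ i → sum λ j → offDiagonal P j i) ⟩
  - (sum λ i → sum λ j → offDiagonal P j i)   ≡⟨ cong -_ (∑-comm (λ i j → offDiagonal P j i)) ⟩
  - (sum λ j → sum λ i → offDiagonal P j i)   ≡⟨ cong -_ (sym (det-pair A q)) ⟩
  - det A ∎)
  where
  P : Fin (suc (suc n)) → Fin (suc (suc n)) → ℤ
  P = pairTerm A q

  left : ∀ s a t u b d → s * a * (t * u * b * d) ≡ (s * t) * (u * (a * b) * d)
  left = solve-∀

  right : ∀ s a t u b d → (- (s * t)) * (u * (a * b) * d) ≡ - (s * b * (t * u * a * d))
  right = solve-∀

  antisymmetric : ∀ i j → i ≢ j → P i j ≡ - P j i
  antisymmetric i j i≢j = begin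
    P i j
      ≡⟨ left (sgn i) (A i zero) (sgn (without i j)) (sgn q) (A j (suc q)) _ ⟩
    (sgn i * sgn (without i j)) * (sgn q * (A i zero * A j (suc q)) * _)
      ≡⟨ cong₂ _*_ (sgn-without i j i≢j)
           (cong₂ (λ a d → sgn q * a * d) (cong₂ _*_ (eq i) (sym (eq j))) (pairTerm-det A q i j i≢j)) ⟩
    (- (sgn j * sgn (without j i))) * (sgn q * (A i (suc q) * A j zero) * _)
      ≡⟨ right (sgn j) (A i (suc q)) (sgn (without j i)) (sgn q) (A j zero) _ ⟩
    - P j i ∎

  negated : ∀ i j → offDiagonal P i j ≡ - offDiagonal P j i
  negated i j with i ≟ j | j ≟ i
  ... | yes _   | yes _   = refl
  ... | yes i≡j | no j≢i  = contradiction (sym i≡j) j≢i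
  ... | no i≢j  | yes j≡i = contradiction (sym j≡i) i≢j
  ... | no i≢j  | no _    = antisymmetric i j i≢j

-- Multilinearity, column operations and rank one updates

δ : ∀ {n} → Fin n → Fin n → ℤ
δ i j = if does (i ≟ j) then 1ℤ else 0ℤ

δ-refl : ∀ {n} (i : Fin n) → δ i i ≡ 1ℤ
δ-refl i = cong (if_then 1ℤ else 0ℤ) (dec-true (i ≟ i) refl)

δ-≢ : ∀ {n} {i j : Fin n} → i ≢ j → δ i j ≡ 0ℤ
δ-≢ {i = i} {j} i≢j = cong (if_then 1ℤ else 0ℤ) (dec-false (i ≟ j) i≢j)

δ-punchIn : ∀ {n} (i : Fin (suc n)) k → δ i (punchIn i k) ≡ 0ℤ
δ-punchIn i k = δ-≢ (punchInᵢ≢i i k ∘ sym)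

sum-δ : ∀ {n} (f : Fin n → ℤ) u → sum (λ i → δ u i * f i) ≡ f u
sum-δ {suc n} f u = begin
  sum (λ i → δ u i * f i)
    ≡⟨ sum-remove {i = u} (λ i → δ u i * f i) ⟩
  δ u u * f u + sum (λ k → δ u (punchIn u k) * f (punchIn u k))
    ≡⟨ cong₂ (λ d s → d * f u + s) (δ-refl u)
         (sum-≡0 λ k → trans (cong (_* f (punchIn u k)) (δ-punchIn u k)) (ℤₚ.*-zeroˡ (f (punchIn u k)))) ⟩
  1ℤ * f u + 0ℤ ≡⟨ trans (ℤₚ.+-identityʳ (1ℤ * f u)) (ℤₚ.*-identityˡ (f u)) ⟩
  f u ∎

sum-linear : ∀ {n} (f g : Fin n → ℤ) c → sum (λ i → f i + c * g i) ≡ sum f + c * sum g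
sum-linear f g c = trans (∑-distrib-+ f (λ i → c * g i)) (cong (λ s → sum f + s) (sym (*-distribˡ-sum c g)))

module _ {n} (A : Matrix (suc n) (suc n)) (v : Fin (suc n)) (a : Fin (suc n) → ℤ) where

  replaceColumn : Matrix (suc n) (suc n)
  replaceColumn i j = if does (v ≟ j) then a i else A i j

  -- Written additively with `δ` so that `colOp` is an instance by computation and rank one updates
  -- differ from it only by ring identities.
  addColumn : ℤ → Matrix (suc n) (suc n)
  addColumn c i j = A i j + δ v j * (c * a i)

  private
    x+1c≡x+c : ∀ x c → x + 1ℤ * c ≡ x + c
    x+1c≡x+c = solve-∀

    x+0c≡x : ∀ x c → x + 0ℤ * c ≡ x
    x+0c≡x = solve-∀

    distribute : ∀ s a c b d → s * (a + c * b) * d ≡ s * a * d + c * (s * b * d)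
    distribute = solve-∀

  addColumn-other : ∀ c i j → v ≢ j → addColumn c i j ≡ A i j
  addColumn-other c i j v≢j = trans (cong (λ d → A i j + d * (c * a i)) (δ-≢ v≢j)) (x+0c≡x (A i j) (c * a i))

  addColumn-self : ∀ c i → addColumn c i v ≡ A i v + c * a i
  addColumn-self c i = trans (cong (λ d → A i v + d * (c * a i)) (δ-refl v)) (x+1c≡x+c (A i v) (c * a i))

  replaceColumn-other : ∀ i j → v ≢ j → replaceColumn i j ≡ A i j
  replaceColumn-other i j v≢j = cong (if_then a i else A i j) (dec-false (v ≟ j) v≢j)

  replaceColumn-self : ∀ i → replaceColumn i v ≡ a i
  replaceColumn-self i = cong (if_then a i else A i v) (dec-true (v ≟ v) refl)

  laplace-replaceColumn : det replaceColumn ≡ sum λ i → sgn i * sgn v * a i * det (minor A i v)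
  laplace-replaceColumn = trans (det-laplace replaceColumn v) (sum-cong-≗ λ i →
    cong₂ (λ x d → sgn i * sgn v * x * d) (replaceColumn-self i)
      (det-cong λ k l → replaceColumn-other (punchIn i k) (punchIn v l) (punchInᵢ≢i v l ∘ sym)))

  det-addColumn : ∀ c → det (addColumn c) ≡ det A + c * det replaceColumn
  det-addColumn c = begin
    det (addColumn c)
      ≡⟨ det-laplace (addColumn c) v ⟩
    (sum λ i → sgn i * sgn v * addColumn c i v * det (minor (addColumn c) i v))
      ≡⟨ sum-cong-≗ (λ i → cong₂ (λ x d → sgn i * sgn v * x * d) (addColumn-self c i)
           (det-cong λ k l → addColumn-other c (punchIn i k) (punchIn v l) (punchInᵢ≢i v l ∘ sym))) ⟩
    (sum λ i → sgn i * sgn v * (A i v + c * a i) * det (minor A i v))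
      ≡⟨ sum-cong-≗ (λ i → distribute (sgn i * sgn v) (A i v) c (a i) (det (minor A i v))) ⟩
    (sum λ i → laplaceTerm A v i + c * (sgn i * sgn v * a i * det (minor A i v)))
      ≡⟨ sum-linear (laplaceTerm A v) (λ i → sgn i * sgn v * a i * det (minor A i v)) c ⟩
    sum (laplaceTerm A v) + c * (sum λ i → sgn i * sgn v * a i * det (minor A i v))
      ≡⟨ cong₂ (λ x y → x + c * y) (sym (det-laplace A v)) (sym laplace-replaceColumn) ⟩
    det A + c * det replaceColumn ∎

colOp : ∀ {n} → ℤ → Fin n → Fin n → Matrix n n → Matrix n n
colOp c u v A i j = A i j + δ v j * (c * A i u)

det-colOp : ∀ {n} c {u v : Fin n} → u ≢ v → ∀ A → det (colOp c u v A) ≡ det A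
det-colOp {suc n} c {u} {v} u≢v A = begin
  det (colOp c u v A)                          ≡⟨ det-addColumn A v (λ i → A i u) c ⟩
  det A + c * det (replaceColumn A v (λ i → A i u)) ≡⟨ cong (λ d → det A + c * d) (det-equalColumns (replaceColumn A v (λ i → A i u)) u≢v λ i →
      trans (replaceColumn-other A v (λ i → A i u) i u (u≢v ∘ sym)) (sym (replaceColumn-self A v (λ i → A i u) i))) ⟩
  det A + c * 0ℤ                               ≡⟨ x+c0≡x (det A) c ⟩
  det A                                        ∎
  where
  x+c0≡x : ∀ x c → x + c * 0ℤ ≡ x
  x+c0≡x = solve-∀

rowOp : ∀ {n} → ℤ → Fin n → Fin n → Matrix n n → Matrix n n
rowOp c u v A = colOp c u v (A ᵀ) ᵀ

det-rowOp : ∀ {n} c {u v : Fin n} → u ≢ v → ∀ A → det (rowOp c u v A) ≡ det A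
det-rowOp c {u} {v} u≢v A = trans (detᵀ (colOp c u v (A ᵀ))) (trans (det-colOp c u≢v (A ᵀ)) (detᵀ A))

-- Linearity in column `u` leaves a determinant whose column `u` is a unit vector. Its expansion has
-- one surviving term, with sign `sgn u * sgn u`.
det-add-δδ : ∀ {n} (A : Matrix (suc n) (suc n)) x u →
             det (λ i j → A i j + x * (δ u i * δ u j)) ≡ det A + x * det (minor A u u)
det-add-δδ A x u = begin
  det (λ i j → A i j + x * (δ u i * δ u j))
    ≡⟨ det-cong (λ i j → cong (λ y → A i j + y) (shuffle x (δ u i) (δ u j))) ⟩
  det (addColumn A u (δ u) x)
    ≡⟨ det-addColumn A u (δ u) x ⟩
  det A + x * det (replaceColumn A u (δ u))
    ≡⟨ cong (λ y → det A + x * y) (begin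
         det (replaceColumn A u (δ u))
           ≡⟨ laplace-replaceColumn A u (δ u) ⟩
         (sum λ i → sgn i * sgn u * δ u i * det (minor A i u))
           ≡⟨ sum-cong-≗ (λ i → pull (sgn i * sgn u) (δ u i) (det (minor A i u))) ⟩
         (sum λ i → δ u i * (sgn i * sgn u * det (minor A i u)))
           ≡⟨ sum-δ (λ i → sgn i * sgn u * det (minor A i u)) u ⟩
         sgn u * sgn u * det (minor A u u)
           ≡⟨ trans (cong (_* det (minor A u u)) (sgn² u)) (ℤₚ.*-identityˡ (det (minor A u u))) ⟩
         det (minor A u u) ∎) ⟩
  det A + x * det (minor A u u) ∎
  where
  shuffle : ∀ x a b → x * (a * b) ≡ b * (x * a)
  shuffle = solve-∀

  pull : ∀ s a d → s * a * d ≡ a * (s * d)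
  pull = solve-∀

det-scale : ∀ {n} (a b : Fin n → ℤ) (A : Matrix n n) →
            det (λ i j → a i * b j * A i j) ≡ ∏ a * ∏ b * det A
det-scale {zero}  a b A = refl
det-scale {suc n} a b A = begin
  (sum λ i → sgn i * (a i * b zero * A i zero) * det (minor (λ i j → a i * b j * A i j) i zero))
    ≡⟨ sum-cong-≗ (λ i → cong (sgn i * (a i * b zero * A i zero) *_)
         (det-scale (a ∘ punchIn i) (b ∘ suc) (minor A i zero))) ⟩
  (sum λ i → sgn i * (a i * b zero * A i zero) * (∏ (a ∘ punchIn i) * ∏ (b ∘ suc) * det (minor A i zero)))
    ≡⟨ sum-cong-≗ (λ i → shuffle (sgn i) (a i) (b zero) (A i zero) (∏ (a ∘ punchIn i)) (∏ (b ∘ suc)) (det (minor A i zero))) ⟩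
  (sum λ i → (a i * ∏ (a ∘ punchIn i)) * ∏ b * (sgn i * A i zero * det (minor A i zero)))
    ≡⟨ sum-cong-≗ (λ i → cong (λ p → p * ∏ b * (sgn i * A i zero * det (minor A i zero))) (sym (∏-remove {i = i} a))) ⟩
  (sum λ i → ∏ a * ∏ b * (sgn i * A i zero * det (minor A i zero)))
    ≡⟨ sym (*-distribˡ-sum (∏ a * ∏ b) (λ i → sgn i * A i zero * det (minor A i zero))) ⟩
  ∏ a * ∏ b * det A ∎
  where
  shuffle : ∀ s a b x p q d → s * (a * b * x) * (p * q * d) ≡ (a * p) * (b * q) * (s * x * d)
  shuffle = solve-∀

det-outerProduct : ∀ {n} (w : Fin (suc (suc n)) → ℤ) → det (λ i j → w i * w j) ≡ 0ℤ
det-outerProduct {n} w = begin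
  det (λ i j → w i * w j)            ≡⟨ det-cong (λ i j → sym (ℤₚ.*-identityʳ (w i * w j))) ⟩
  det (λ i j → w i * w j * 1ℤ)       ≡⟨ det-scale w w ones ⟩
  ∏ w * ∏ w * det ones               ≡⟨ cong (∏ w * ∏ w *_) (det-equalColumns ones {zero} {suc zero} (λ ()) (λ _ → refl)) ⟩
  ∏ w * ∏ w * 0ℤ                     ≡⟨ ℤₚ.*-zeroʳ (∏ w * ∏ w) ⟩
  0ℤ                                 ∎
  where
  ones : Matrix (suc (suc n)) (suc (suc n))
  ones _ _ = 1ℤ

-- The cokernel of a nonsingular matrix

*ᵥ-congˡ : ∀ {m n} (A B : Matrix m n) → A ≋ B → ∀ y → A *ᵥ y ≗ B *ᵥ y
*ᵥ-congˡ A B A≋B y i = sum-cong-≗ λ j → cong (_* y j) (A≋B i j)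

colOp-self : ∀ {n} c (u v : Fin n) (A : Matrix n n) i → colOp c u v A i v ≡ A i v + c * A i u
colOp-self c u v A i = trans (cong (λ d → A i v + d * (c * A i u)) (δ-refl v)) (identity (A i v) (c * A i u))
  where
  identity : ∀ x y → x + 1ℤ * y ≡ x + y
  identity = solve-∀

colOp-other : ∀ {n} c (u v : Fin n) (A : Matrix n n) i {j} → v ≢ j → colOp c u v A i j ≡ A i j
colOp-other c u v A i {j} v≢j = trans (cong (λ d → A i j + d * (c * A i u)) (δ-≢ v≢j)) (identity (A i j) (c * A i u))
  where
  identity : ∀ x y → x + 0ℤ * y ≡ x
  identity = solve-∀

colOp-inverse : ∀ {n} c {u v : Fin n} → u ≢ v → ∀ A → colOp (- c) u v (colOp c u v A) ≋ A
colOp-inverse c {u} {v} u≢v A i j = trans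
  (cong (λ x → colOp c u v A i j + δ v j * (- c * x)) (colOp-other c u v A i (u≢v ∘ sym)))
  (identity (A i j) (δ v j) c (A i u))
  where
  identity : ∀ x d c y → (x + d * (c * y)) + d * (- c * y) ≡ x
  identity = solve-∀

-- A column operation is right multiplication by an elementary matrix, which may be applied to the
-- vector instead.
colOp-*ᵥ : ∀ {n} c (u v : Fin n) A y i →
           (colOp c u v A *ᵥ y) i ≡ (A *ᵥ λ j → y j + δ u j * (c * y v)) i
colOp-*ᵥ c u v A y i = begin
  (sum λ j → (A i j + δ v j * (c * A i u)) * y j)
    ≡⟨ sum-cong-≗ (λ j → left (A i j) (δ v j) c (A i u) (y j)) ⟩
  (sum λ j → A i j * y j + c * (δ v j * (A i u * y j)))
    ≡⟨ sum-linear (λ j → A i j * y j) (λ j → δ v j * (A i u * y j)) c ⟩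
  (A *ᵥ y) i + c * (sum λ j → δ v j * (A i u * y j))
    ≡⟨ cong (λ s → (A *ᵥ y) i + c * s) (trans (sum-δ (λ j → A i u * y j) v)
         (sym (sum-δ (λ j → A i j * y v) u))) ⟩
  (A *ᵥ y) i + c * (sum λ j → δ u j * (A i j * y v))
    ≡⟨ sym (sum-linear (λ j → A i j * y j) (λ j → δ u j * (A i j * y v)) c) ⟩
  (sum λ j → A i j * y j + c * (δ u j * (A i j * y v)))
    ≡⟨ sum-cong-≗ (λ j → right (A i j) (y j) c (δ u j) (y v)) ⟩
  (A *ᵥ λ j → y j + δ u j * (c * y v)) i ∎
  where
  left : ∀ x d c z y → (x + d * (c * z)) * y ≡ x * y + c * (d * (z * y))
  left = solve-∀

  right : ∀ x y c d z → x * y + c * (d * (x * z)) ≡ x * (y + d * (c * z))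
  right = solve-∀

infix 4 _⊑_ _~_

record _⊑_ {n} (A B : Matrix n n) : Set where
  constructor include
  field
    included : ∀ y → ∃[ z ] A *ᵥ y ≗ B *ᵥ z

-- The two consequences of differing by a unimodular factor on the right that matter below.
-- Recording them directly avoids carrying the transformation matrix.
record _~_ {n} (A B : Matrix n n) : Set where
  field
    det-≡ : det A ≡ det B
    image⊑ : A ⊑ B
    image⊒ : B ⊑ A

open _⊑_

⊑-refl : ∀ {n} {A : Matrix n n} → A ⊑ A
⊑-refl = include λ y → y , λ _ → refl

~-refl : ∀ {n} {A : Matrix n n} → A ~ A
~-refl = record { det-≡ = refl ; image⊑ = ⊑-refl ; image⊒ = ⊑-refl }

⊑-trans : ∀ {n} {A B C : Matrix n n} → A ⊑ B → B ⊑ C → A ⊑ C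
⊑-trans A⊑B B⊑C = include λ y →
  let z , p = included A⊑B y ; w , q = included B⊑C z in w , λ i → trans (p i) (q i)

~-trans : ∀ {n} {A B C : Matrix n n} → A ~ B → B ~ C → A ~ C
~-trans p q = record
  { det-≡  = trans p.det-≡ q.det-≡
  ; image⊑ = ⊑-trans p.image⊑ q.image⊑
  ; image⊒ = ⊑-trans q.image⊒ p.image⊒ }
  where
  module p = _~_ p
  module q = _~_ q

~-colOp : ∀ {n} c (u v : Fin n) → u ≢ v → (A : Matrix n n) → A ~ colOp c u v A
~-colOp c u v u≢v A = record
  { det-≡  = sym (det-colOp c u≢v A)
  ; image⊑ = include λ y → _ , λ i → trans
      (sym (*ᵥ-congˡ (colOp (- c) u v (colOp c u v A)) A (colOp-inverse c u≢v A) y i)) (colOp-*ᵥ (- c) u v (colOp c u v A) y i)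
  ; image⊒ = include λ y → _ , colOp-*ᵥ c u v A y }

-- The Euclidean algorithm by column operations on the entries 0 and suc k of row 0.
clearEntry : ∀ {n} (A : Matrix (suc n) (suc n)) k → Acc _<_ ∣ A zero (suc k) ∣ →
             ∃[ B ] A ~ B × B zero (suc k) ≡ 0ℤ × (∀ l → l ≢ k → B zero (suc l) ≡ A zero (suc l))
clearEntry {n} A k (acc rec) with A zero (suc k) ℤₚ.≟ 0ℤ
... | yes a≡0 = A , ~-refl , a≡0 , λ _ _ → refl
... | no a≢0 = continue
  where
  a = A zero (suc k)
  instance _ = ≢-nonZero a≢0
  q = A zero zero ℤ./ a

  B₁ : Matrix (suc n) (suc n)
  B₁ = colOp (- q) (suc k) zero A

  A~B₁ : A ~ B₁
  A~B₁ = ~-colOp (- q) (suc k) zero (λ ()) A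

  remainder : ∀ x a q r → x ≡ r + q * a → x + - q * a ≡ r
  remainder x a q r x≡r+qa = trans (cong (λ x → x + - q * a) x≡r+qa) (identity r q a)
    where
    identity : ∀ r q a → r + q * a + - q * a ≡ r
    identity = solve-∀

  B₁-head : B₁ zero zero ≡ + (A zero zero ℤ.% a)
  B₁-head = trans (colOp-self (- q) (suc k) zero A zero)
    (remainder (A zero zero) a q _ (ℤ.a≡a%n+[a/n]*n (A zero zero) a))

  B₁-tail : ∀ l → B₁ zero (suc l) ≡ A zero (suc l)
  B₁-tail l = colOp-other (- q) (suc k) zero A zero (λ ())

  suc≢ : ∀ {l} → l ≢ k → suc k ≢ suc l
  suc≢ l≢k = l≢k ∘ sym ∘ suc-injective

  continue : ∃[ B ] A ~ B × B zero (suc k) ≡ 0ℤ × (∀ l → l ≢ k → B zero (suc l) ≡ A zero (suc l))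
  continue with B₁ zero zero ℤₚ.≟ 0ℤ
  -- With `a` dividing the head, the head of `B₁` is 0. Adding column `suc k` to column 0 and
  -- subtracting back moves `a` into the head and leaves 0 behind, without the sign change of a
  -- swap.
  ... | yes ρ≡0 = B₃ , ~-trans A~B₁ (~-trans (~-colOp 1ℤ (suc k) zero (λ ()) B₁) (~-colOp (- 1ℤ) zero (suc k) (λ ()) B₂)) ,
      trans (colOp-self (- 1ℤ) zero (suc k) B₂ zero)
        (trans (cong₂ (λ x y → x + - 1ℤ * y) (B₂-tail k)
                 (trans (colOp-self 1ℤ (suc k) zero B₁ zero) (cong₂ (λ x y → x + 1ℤ * y) ρ≡0 (B₁-tail k))))
               (cancel a)) ,
      λ l l≢k → trans (colOp-other (- 1ℤ) zero (suc k) B₂ zero (suc≢ l≢k)) (B₂-tail l)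
    where
    B₂ B₃ : Matrix (suc n) (suc n)
    B₂ = colOp 1ℤ (suc k) zero B₁
    B₃ = colOp (- 1ℤ) zero (suc k) B₂

    B₂-tail : ∀ l → B₂ zero (suc l) ≡ A zero (suc l)
    B₂-tail l = trans (colOp-other 1ℤ (suc k) zero B₁ zero (λ ())) (B₁-tail l)

    cancel : ∀ a → a + - 1ℤ * (0ℤ + 1ℤ * a) ≡ 0ℤ
    cancel = solve-∀
  -- The measure is the entry at `suc k`, which the first division leaves alone. A second division,
  -- by the remainder `ρ`, lowers it: the new entry is below `∣ ρ ∣`, which is below `∣ a ∣`.
  ... | no ρ≢0 =
      let C , B₂~C , C≡0 , same = clearEntry B₂ k (rec smaller) in
      C , ~-trans A~B₁ (~-trans (~-colOp (- q′) zero (suc k) (λ ()) B₁) B₂~C) , C≡0 ,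
      λ l l≢k → trans (same l l≢k)
        (trans (colOp-other (- q′) zero (suc k) B₁ zero (suc≢ l≢k)) (B₁-tail l))
    where
    ρ = B₁ zero zero
    instance _ = ≢-nonZero ρ≢0
    q′ = a ℤ./ ρ

    B₂ : Matrix (suc n) (suc n)
    B₂ = colOp (- q′) zero (suc k) B₁

    B₂-entry : B₂ zero (suc k) ≡ + (a ℤ.% ρ)
    B₂-entry = trans (colOp-self (- q′) zero (suc k) B₁ zero)
      (trans (cong (λ x → x + - q′ * ρ) (B₁-tail k)) (remainder a ρ q′ _ (ℤ.a≡a%n+[a/n]*n a ρ)))

    smaller : ∣ B₂ zero (suc k) ∣ < ∣ a ∣
    smaller = subst (_< ∣ a ∣) (sym (cong ∣_∣ B₂-entry))
      (ℕₚ.<-trans (ℤ.n%d<d a ρ) (subst (_< ∣ a ∣) (sym (cong ∣_∣ B₁-head)) (ℤ.n%d<d (A zero zero) a)))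

clearEntries : ∀ {n} (A : Matrix (suc n) (suc n)) (ks : List (Fin n)) →
               ∃[ B ] A ~ B × (∀ {k} → k ∈ₗ ks → B zero (suc k) ≡ 0ℤ)
clearEntries A [] = A , ~-refl , λ ()
clearEntries {n} A (k ∷ ks) =
  let B , A~B , B≡0 = clearEntries A ks
      C , B~C , C≡0 , same = clearEntry B k (<-wellFounded ∣ B zero (suc k) ∣)
      C-tail : ∀ {l} → l ∈ₗ ks → C zero (suc l) ≡ 0ℤ
      C-tail {l} l∈ks = decide B C C≡0 same B≡0 l∈ks (l ≟ k)
  in C , ~-trans A~B B~C , λ { (here refl) → C≡0 ; (there l∈ks) → C-tail l∈ks }
  where
  -- `k` may occur again in `ks`, and `same` says nothing about `k` itself.
  decide : ∀ (B C : Matrix (suc n) (suc n)) → C zero (suc k) ≡ 0ℤ →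
           (∀ l → l ≢ k → C zero (suc l) ≡ B zero (suc l)) →
           (∀ {l} → l ∈ₗ ks → B zero (suc l) ≡ 0ℤ) →
           ∀ {l} → l ∈ₗ ks → Dec (l ≡ k) → C zero (suc l) ≡ 0ℤ
  decide B C C≡0 same B≡0 l∈ks (yes refl) = C≡0
  decide B C C≡0 same B≡0 l∈ks (no l≢k)   = trans (same _ l≢k) (B≡0 l∈ks)

det-clearedRow : ∀ {n} (B : Matrix (suc n) (suc n)) → (∀ k → B zero (suc k) ≡ 0ℤ) →
                 det B ≡ B zero zero * det (minor B zero zero)
det-clearedRow B B≡0 = begin
  det B       ≡⟨ sym (detᵀ B) ⟩
  det (B ᵀ)   ≡⟨ cong₂ _+_ (cong₂ _*_ (ℤₚ.*-identityˡ (B zero zero)) (detᵀ (minor B zero zero)))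
                   (sum-≡0 λ k → trans (cong (λ x → sgn (suc k) * x * det (minor (B ᵀ) (suc k) zero)) (B≡0 k))
                     (vanish (sgn (suc k)) (det (minor (B ᵀ) (suc k) zero)))) ⟩
  B zero zero * det (minor B zero zero) + 0ℤ ≡⟨ ℤₚ.+-identityʳ _ ⟩
  B zero zero * det (minor B zero zero) ∎
  where
  vanish : ∀ s d → s * 0ℤ * d ≡ 0ℤ
  vanish = solve-∀

-- Representatives of the cokernel

TorsionModImage : ∀ {n} → Matrix n n → (Fin n → ℤ) → Set
TorsionModImage {n} A x = Σ[ k ∈ ℤ ] k ≢ 0ℤ × (Σ[ y ∈ (Fin n → ℤ) ] ∀ i → k * x i ≡ (A *ᵥ y) i)

-- Explicit representatives are what `HasOrder` asks for. `torsion` is built by the same recursion;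
-- its multiplier is an integer because it is a product of diagonal entries of either sign.
record Transversal {n} (A : Matrix n n) (N : ℕ) : Set where
  field
    rep      : Fin N → Fin n → ℤ
    distinct : ∀ {i j} → _≡_modImage A (rep i) (rep j) → i ≡ j
    complete : ∀ x → Σ[ i ∈ Fin N ] _≡_modImage A (rep i) x
    torsion  : ∀ x → TorsionModImage A x

transversal-~ : ∀ {n} {A B : Matrix n n} {N} → A ~ B → Transversal B N → Transversal A N
transversal-~ {A = A} {B} A~B T = record
  { rep      = rep
  ; distinct = λ (y , p) → let z , q = included image⊑ y in distinct (z , λ k → trans (p k) (q k))
  ; complete = λ x → let i , (y , p) = complete x ; z , q = included image⊒ y in i , (z , λ k → trans (p k) (q k))
  ; torsion  = λ x → let k , k≢0 , y , p = torsion x ; z , q = included image⊒ y in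
      k , k≢0 , z , λ i → trans (p i) (q i)
  }
  where
  open Transversal T
  open _~_ A~B

module _ {n} (B : Matrix (suc n) (suc n)) (B≡0 : ∀ k → B zero (suc k) ≡ 0ℤ)
         (g≢0 : B zero zero ≢ 0ℤ) {N} (T : Transversal (minor B zero zero) N) where
  private
    module T = Transversal T

    g = B zero zero
    B′ = minor B zero zero

    instance _ = ≢-nonZero g≢0

    cons : ℤ → (Fin n → ℤ) → Fin (suc n) → ℤ
    cons x y zero    = x
    cons x y (suc i) = y i

    *ᵥ-head : ∀ y → (B *ᵥ y) zero ≡ g * y zero
    *ᵥ-head y = trans (cong (λ s → g * y zero + s)
      (sum-≡0 λ k → trans (cong (_* y (suc k)) (B≡0 k)) (ℤₚ.*-zeroˡ (y (suc k)))))
      (ℤₚ.+-identityʳ (g * y zero))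

    split : Fin (∣ g ∣ ℕ.* N) → Fin ∣ g ∣ × Fin N
    split = remQuot {∣ g ∣} N

    rep : Fin (∣ g ∣ ℕ.* N) → Fin (suc n) → ℤ
    rep i = cons (+ toℕ (proj₁ (split i))) (T.rep (proj₂ (split i)))

    -- Residues below `∣ g ∣` differ by less than `∣ g ∣`, so the quotient has absolute value below
    -- 1. That `q` vanishes is returned too: it removes column 0 from the remaining equations.
    congruent-≡ : ∀ (c c′ : Fin ∣ g ∣) q → + toℕ c - + toℕ c′ ≡ g * q → c ≡ c′ × q ≡ 0ℤ
    congruent-≡ c c′ q eq = toℕ-injective (ℤₚ.+-injective (ℤₚ.i-j≡0⇒i≡j _ _ (trans eq (trans (cong (g *_) q≡0) (ℤₚ.*-zeroʳ g))))) , q≡0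
      where
      small : ∣ g ∣ ℕ.* ∣ q ∣ < ∣ g ∣ ℕ.* 1
      small = subst₂ _<_
        (trans (cong ∣_∣ (trans (sym (ℤₚ.m-n≡m⊖n (toℕ c) (toℕ c′))) eq)) (ℤₚ.abs-* g q))
        (sym (ℕₚ.*-identityʳ ∣ g ∣))
        (ℕₚ.≤-<-trans (ℤₚ.∣m⊝n∣≤m⊔n (toℕ c) (toℕ c′)) (ℕₚ.⊔-pres-<m (toℕ<n c) (toℕ<n c′)))

      q≡0 : q ≡ 0ℤ
      q≡0 = ℤₚ.∣i∣≡0⇒i≡0 (ℕₚ.n<1⇒n≡0 (ℕₚ.*-cancelˡ-< ∣ g ∣ _ _ small))

    distinct : ∀ {i j} → _≡_modImage B (rep i) (rep j) → i ≡ j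
    distinct {i} {j} (y , p) = begin
      i                                          ≡⟨ sym (combine-remQuot {∣ g ∣} N i) ⟩
      combine (proj₁ (split i)) (proj₂ (split i)) ≡⟨ cong₂ combine c≡c′ (T.distinct (y ∘ suc , tail)) ⟩
      combine (proj₁ (split j)) (proj₂ (split j)) ≡⟨ combine-remQuot {∣ g ∣} N j ⟩
      j                                          ∎
      where
      head = congruent-≡ (proj₁ (split i)) (proj₁ (split j)) (y zero) (trans (p zero) (*ᵥ-head y))
      c≡c′ = proj₁ head

      tail : ∀ k → T.rep (proj₂ (split i)) k - T.rep (proj₂ (split j)) k ≡ (B′ *ᵥ (y ∘ suc)) k
      tail k = trans (p (suc k)) (trans (cong (λ z → B (suc k) zero * z + (B′ *ᵥ (y ∘ suc)) k) (proj₂ head))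
        (identity (B (suc k) zero) _))
        where
        identity : ∀ b s → b * 0ℤ + s ≡ s
        identity = solve-∀

    rep-combine : ∀ c i → rep (combine c i) ≗ cons (+ toℕ c) (T.rep i)
    rep-combine c i k = cong (λ s → cons (+ toℕ (proj₁ s)) (T.rep (proj₂ s)) k) (remQuot-combine c i)

    complete : ∀ x → Σ[ i ∈ Fin (∣ g ∣ ℕ.* N) ] _≡_modImage B (rep i) x
    complete x = combine c i , (cons (- q) y , λ k → trans (cong (_- x k) (rep-combine c i k)) (difference k))
      where
      q = x zero ℤ./ g
      c = fromℕ< (ℤ.n%d<d (x zero) g)
      x′ : Fin n → ℤ
      -- Subtracting `q` times column 0 of `B` reduces the head of `x` to its residue `c`; this is
      -- the tail that is left.
      x′ k = x (suc k) - q * B (suc k) zero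
      i = proj₁ (T.complete x′)
      y = _≡_modImage.preimage (proj₂ (T.complete x′))

      head : ∀ r q g x → x ≡ r + q * g → r - x ≡ g * - q
      head r q g x x≡r+qg = trans (cong (λ x → r - x) x≡r+qg) (identity r q g)
        where
        identity : ∀ r q g → r - (r + q * g) ≡ g * - q
        identity = solve-∀

      tail : ∀ r x q b s → r - (x - q * b) ≡ s → r - x ≡ b * - q + s
      tail r x q b s eq = trans (identity r x q b) (cong (λ s → b * - q + s) eq)
        where
        identity : ∀ r x q b → r - x ≡ b * - q + (r - (x - q * b))
        identity = solve-∀

      difference : ∀ k → cons (+ toℕ c) (T.rep i) k - x k ≡ (B *ᵥ cons (- q) y) k
      difference zero = trans
        (head (+ toℕ c) q g (x zero) (trans (ℤ.a≡a%n+[a/n]*n (x zero) g)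
          (cong (λ r → + r + q * g) (sym (toℕ-fromℕ< (ℤ.n%d<d (x zero) g))))))
        (sym (*ᵥ-head (cons (- q) y)))
      difference (suc k) = tail (T.rep i k) (x (suc k)) q (B (suc k) zero) _
        (_≡_modImage.difference (proj₂ (T.complete x′)) k)

    torsion : ∀ x → TorsionModImage B x
    torsion x =
      -- `g` times `x` minus `x zero` times column 0 has head 0, so a multiple of its tail can be
      -- found in the image of the minor.
      let k , k≢0 , y , p = T.torsion (λ i → g * x (suc i) - x zero * B (suc i) zero) in
      k * g , nonzero k k≢0 , cons (k * x zero) y ,
      λ { zero    → trans (head k g (x zero)) (sym (*ᵥ-head (cons (k * x zero) y)))
        ; (suc i) → trans (tail k g (x (suc i)) (x zero) (B (suc i) zero))
                      (cong (λ s → B (suc i) zero * (k * x zero) + s) (p i)) }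
      where
      nonzero : ∀ k → k ≢ 0ℤ → k * g ≢ 0ℤ
      nonzero k k≢0 kg≡0 with ℤₚ.i*j≡0⇒i≡0∨j≡0 k kg≡0
      ... | inj₁ k≡0 = k≢0 k≡0
      ... | inj₂ g≡0 = g≢0 g≡0

      head : ∀ k g x → k * g * x ≡ g * (k * x)
      head = solve-∀

      tail : ∀ k g x x₀ b → k * g * x ≡ b * (k * x₀) + k * (g * x - x₀ * b)
      tail = solve-∀

  -- With row 0 equal to `(g, 0, …, 0)` the image restricts the head modulo `g`, and an image vector
  -- with head 0 has its tail in the image of the minor. Residues and representatives of the minor
  -- therefore combine freely.
  transversal-clearedRow : Transversal B (∣ g ∣ ℕ.* N)
  transversal-clearedRow = record { rep = rep ; distinct = distinct ; complete = complete ; torsion = torsion }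

transversal : ∀ {n} (A : Matrix n n) → det A ≢ 0ℤ → Transversal A ∣ det A ∣
transversal {zero}  A detA≢0 = record
  { rep      = λ _ ()
  ; distinct = λ { {zero} {zero} _ → refl }
  ; complete = λ x → zero , ((λ ()) , λ ())
  ; torsion  = λ x → 1ℤ , (λ ()) , (λ ()) , λ ()
  }
transversal {suc n} A detA≢0 =
  let B , A~B , cleared = clearEntries A (allFin n)
      B≡0 : ∀ k → B zero (suc k) ≡ 0ℤ
      B≡0 k = cleared (∈-allFin k)
      detA≡ = trans (_~_.det-≡ A~B) (det-clearedRow B B≡0)
      g≢0 : B zero zero ≢ 0ℤ
      g≢0 g≡0 = detA≢0 (trans detA≡ (trans (cong (_* det (minor B zero zero)) g≡0) (ℤₚ.*-zeroˡ (det (minor B zero zero)))))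
      det′≢0 : det (minor B zero zero) ≢ 0ℤ
      det′≢0 d≡0 = detA≢0 (trans detA≡ (trans (cong (B zero zero *_) d≡0) (ℤₚ.*-zeroʳ (B zero zero))))
  in subst (Transversal A) (trans (sym (ℤₚ.abs-* (B zero zero) _)) (cong ∣_∣ (sym detA≡)))
       (transversal-~ A~B (transversal-clearedRow B B≡0 g≢0 (transversal (minor B zero zero) det′≢0)))

-- The weighted matrix-tree theorem by deletion and contraction

-- Loops are allowed here, unlike in `Multigraph`: contracting an edge turns its parallels into
-- loops.
Ends : ℕ → ℕ → Set
Ends m k = Fin m → Fin k × Fin k

merge : ∀ {k} (u v : Fin (suc k)) → u ≢ v → Fin (suc k) → Fin k
merge u v u≢v p with u ≟ p
... | yes _  = punchOut u≢v
... | no u≢p = punchOut u≢p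

contract : ∀ {k m} (u v : Fin (suc k)) → u ≢ v → Ends m (suc k) → Ends m k
contract u v u≢v ends e = merge u v u≢v (proj₁ (ends e)) , merge u v u≢v (proj₂ (ends e))

-- The Kirchhoff polynomial evaluated at `x`, by its deletion and contraction recursion. A loop lies
-- in no tree and is dropped; without edges only the single vertex has a spanning tree.
treeSum : ∀ {m k} → Ends m k → (Fin m → ℕ) → ℕ
treeSum {zero}  {suc zero} ends x = 1
treeSum {zero}  {_}        ends x = 0
treeSum {suc m} {zero}     ends x = 0
treeSum {suc m} {suc k}    ends x with proj₁ (ends zero) ≟ proj₂ (ends zero)
... | yes _  = treeSum (ends ∘ suc) (x ∘ suc)
... | no u≢v = treeSum (ends ∘ suc) (x ∘ suc) ℕ.+
               x zero ℕ.* treeSum (contract _ _ u≢v (ends ∘ suc)) (x ∘ suc)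

incidence : ∀ {k m} → Ends m k → Fin m → Fin k → ℤ
incidence ends e i = δ (proj₁ (ends e)) i - δ (proj₂ (ends e)) i

-- The sum of `x_e b_e b_eᵀ` over the edges, with `b_e` the incidence vector, plus `w wᵀ`. The
-- recursion makes deletion of edge `zero` hold by computation.
augmentedLaplacian : ∀ {k m} → Ends m k → (Fin m → ℕ) → (Fin k → ℤ) → Matrix k k
augmentedLaplacian {m = zero}  ends x w i j = w i * w j
augmentedLaplacian {m = suc m} ends x w i j =
  augmentedLaplacian (ends ∘ suc) (x ∘ suc) w i j + + x zero * (incidence ends zero i * incidence ends zero j)

δ-punchOut : ∀ {k} {u p : Fin (suc k)} (u≢p : u ≢ p) i → δ p (punchIn u i) ≡ δ (punchOut u≢p) i
δ-punchOut {u = u} {p} u≢p i with punchOut u≢p ≟ i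
... | yes refl = trans (cong (δ p) (punchIn-punchOut u≢p)) (δ-refl p)
... | no ≢i = δ-≢ λ p≡ → ≢i (punchIn-injective u _ _ (trans (punchIn-punchOut u≢p) p≡))

module _ {k} (u v : Fin (suc k)) (u≢v : u ≢ v) where

  -- The linear map induced by `merge`: the vertex `u` disappears and its entry is added to that of
  -- `v`.
  pushforward : (Fin (suc k) → ℤ) → Fin k → ℤ
  pushforward a i = a (punchIn u i) + δ v (punchIn u i) * a u

  pushforward-δ : ∀ p i → pushforward (δ p) i ≡ δ (merge u v u≢v p) i
  pushforward-δ p i with u ≟ p
  ... | yes refl = trans (cong₂ (λ x y → x + δ v (punchIn u i) * y) (δ-punchIn u i) (δ-refl u))
                     (trans (identity (δ v (punchIn u i))) (δ-punchOut u≢v i))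
    where
    identity : ∀ x → 0ℤ + x * 1ℤ ≡ x
    identity = solve-∀
  ... | no u≢p = trans (cong (λ y → δ p (punchIn u i) + δ v (punchIn u i) * y) (δ-≢ (u≢p ∘ sym)))
                   (trans (identity (δ p (punchIn u i)) (δ v (punchIn u i))) (δ-punchOut u≢p i))
    where
    identity : ∀ x y → x + y * 0ℤ ≡ x
    identity = solve-∀

  pushforward-incidence : ∀ {m} (ends : Ends m (suc k)) e i →
                          pushforward (incidence ends e) i ≡ incidence (contract u v u≢v ends) e i
  pushforward-incidence ends e i = trans
    (identity (δ p i′) (δ q i′) (δ v i′) (δ p u) (δ q u))
    (cong₂ _-_ (pushforward-δ p i) (pushforward-δ q i))
    where
    p = proj₁ (ends e)
    q = proj₂ (ends e)
    i′ = punchIn u i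
    identity : ∀ a b c d e → (a - b) + c * (d - e) ≡ (a + c * d) - (b + c * e)
    identity = solve-∀

  sum-pushforward : ∀ a → sum (pushforward a) ≡ sum a
  sum-pushforward a = begin
    sum (pushforward a)
      ≡⟨ ∑-distrib-+ (a ∘ punchIn u) (λ i → δ v (punchIn u i) * a u) ⟩
    sum (a ∘ punchIn u) + sum (λ i → δ v (punchIn u i) * a u)
      ≡⟨ cong (λ s → sum (a ∘ punchIn u) + s) (trans
           (sum-cong-≗ λ i → cong (_* a u) (δ-punchOut u≢v i)) (sum-δ (λ _ → a u) (punchOut u≢v))) ⟩
    sum (a ∘ punchIn u) + a u
      ≡⟨ ℤₚ.+-comm (sum (a ∘ punchIn u)) (a u) ⟩
    a u + sum (a ∘ punchIn u)
      ≡⟨ sym (sum-remove {i = u} a) ⟩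
    sum a ∎

  -- The congruence `P A Pᵀ` with `P` of determinant 1 chosen so that `P (δ u - δ v) = δ u`; the
  -- coordinates of `P a` other than `u` are `pushforward a`.
  congruent : Matrix (suc k) (suc k) → Matrix (suc k) (suc k)
  congruent A = rowOp 1ℤ u v (colOp 1ℤ u v A)

  det-congruent : ∀ A → det (congruent A) ≡ det A
  det-congruent A = trans (det-rowOp 1ℤ u≢v (colOp 1ℤ u v A)) (det-colOp 1ℤ u≢v A)

  congruent-outer : ∀ (a : Fin (suc k) → ℤ) i j →
                    congruent (λ i j → a i * a j) i j ≡ (a i + δ v i * a u) * (a j + δ v j * a u)
  congruent-outer a i j = identity (a i) (a j) (a u) (δ v i) (δ v j)
    where
    identity : ∀ x y z d e → (x * y + e * (1ℤ * (x * z))) + d * (1ℤ * (z * y + e * (1ℤ * (z * z)))) ≡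
                             (x + d * z) * (y + e * z)
    identity = solve-∀

  congruent-+ : ∀ A c B i j → congruent (λ i j → A i j + c * B i j) i j ≡ congruent A i j + c * congruent B i j
  congruent-+ A c B i j = identity (A i j) (A i u) (A u j) (A u u) c (B i j) (B i u) (B u j) (B u u) (δ v i) (δ v j)
    where
    identity : ∀ x y z w c x′ y′ z′ w′ d e →
      ((x + c * x′) + e * (1ℤ * (y + c * y′))) + d * (1ℤ * ((z + c * z′) + e * (1ℤ * (w + c * w′)))) ≡
      (x + e * (1ℤ * y)) + d * (1ℤ * (z + e * (1ℤ * w))) +
      c * ((x′ + e * (1ℤ * y′)) + d * (1ℤ * (z′ + e * (1ℤ * w′))))
    identity = solve-∀

  -- The congruence acts on each rank one summand `a aᵀ` through `a`, and dropping the coordinate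
  -- `u` then gives the summand of the contracted graph.
  minor-congruent : ∀ {m} (ends : Ends m (suc k)) x w →
                    minor (congruent (augmentedLaplacian ends x w)) u u ≋
                    augmentedLaplacian (contract u v u≢v ends) x (pushforward w)
  minor-congruent {zero}  ends x w i j = congruent-outer w (punchIn u i) (punchIn u j)
  minor-congruent {suc m} ends x w i j = begin
    congruent (λ i j → A i j + + x zero * (b i * b j)) (punchIn u i) (punchIn u j)
      ≡⟨ congruent-+ A (+ x zero) (λ i j → b i * b j) (punchIn u i) (punchIn u j) ⟩
    congruent A (punchIn u i) (punchIn u j) + + x zero * congruent (λ i j → b i * b j) (punchIn u i) (punchIn u j)
      ≡⟨ cong₂ (λ y z → y + + x zero * z) (minor-congruent (ends ∘ suc) (x ∘ suc) w i j)
           (trans (congruent-outer b (punchIn u i) (punchIn u j))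
             (cong₂ _*_ (pushforward-incidence ends zero i) (pushforward-incidence ends zero j))) ⟩
    augmentedLaplacian (contract u v u≢v ends) x (pushforward w) i j ∎
    where
    A : Matrix (suc k) (suc k)
    A = augmentedLaplacian (ends ∘ suc) (x ∘ suc) w

    b : Fin (suc k) → ℤ
    b = incidence ends zero

  -- After the congruence the summand of the edge is concentrated in the diagonal entry at `u`, so
  -- `det-add-δδ` applies.
  det-add-edge : ∀ A c → det (λ i j → A i j + c * ((δ u i - δ v i) * (δ u j - δ v j))) ≡
                         det A + c * det (minor (congruent A) u u)
  det-add-edge A c = begin
    det (λ i j → A i j + c * B i j)
      ≡⟨ sym (det-congruent (λ i j → A i j + c * B i j)) ⟩
    det (congruent (λ i j → A i j + c * B i j))
      ≡⟨ det-cong (λ i j → trans (congruent-+ A c B i j) (cong (λ y → congruent A i j + c * y)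
           (trans (congruent-outer b i j) (cong₂ _*_ (straighten i) (straighten j))))) ⟩
    det (λ i j → congruent A i j + c * (δ u i * δ u j))
      ≡⟨ det-add-δδ (congruent A) c u ⟩
    det (congruent A) + c * det (minor (congruent A) u u)
      ≡⟨ cong (λ d → d + c * det (minor (congruent A) u u)) (det-congruent A) ⟩
    det A + c * det (minor (congruent A) u u) ∎
    where
    b : Fin (suc k) → ℤ
    b i = δ u i - δ v i

    B : Matrix (suc k) (suc k)
    B i j = b i * b j

    straighten : ∀ i → b i + δ v i * b u ≡ δ u i
    straighten i = trans (cong₂ (λ x y → b i + δ v i * (x - y)) (δ-refl u) (δ-≢ (u≢v ∘ sym)))
      (identity (δ u i) (δ v i))
      where
      identity : ∀ x y → (x - y) + y * (1ℤ - 0ℤ) ≡ x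
      identity = solve-∀

-- The vector `w` must be arbitrary, as contraction replaces it by its pushforward, whose sum is the
-- same. Without edges the matrix is `w wᵀ`: its determinant is the square of `w zero` on one vertex
-- and vanishes on more.
det-augmentedLaplacian : ∀ {k m} (ends : Ends m (suc k)) x w →
  det (augmentedLaplacian ends x w) ≡ sum w * sum w * + treeSum ends x
det-augmentedLaplacian {zero} {zero} ends x w = identity (w zero)
  where
  identity : ∀ a → 1ℤ * (a * a) * 1ℤ + 0ℤ ≡ (a + 0ℤ) * (a + 0ℤ) * 1ℤ
  identity = solve-∀
det-augmentedLaplacian {suc k} {zero} ends x w = trans (det-outerProduct w) (sym (ℤₚ.*-zeroʳ (sum w * sum w)))
det-augmentedLaplacian {k} {suc m} ends x w with proj₁ (ends zero) ≟ proj₂ (ends zero)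
... | yes u≡v = trans
    (det-cong λ i j → trans (cong (λ b → A i j + + x zero * (b * incidence ends zero j))
        (trans (cong (λ p → δ p i - δ (proj₂ (ends zero)) i) u≡v) (ℤₚ.+-inverseʳ (δ (proj₂ (ends zero)) i))))
      (identity (A i j) (+ x zero) (incidence ends zero j)))
    (det-augmentedLaplacian (ends ∘ suc) (x ∘ suc) w)
  where
  A : Matrix (suc k) (suc k)
  A = augmentedLaplacian (ends ∘ suc) (x ∘ suc) w

  identity : ∀ a c b → a + c * (0ℤ * b) ≡ a
  identity = solve-∀
-- On a single vertex every edge is a loop.
det-augmentedLaplacian {zero} {suc m} ends x w | no u≢v with proj₁ (ends zero) | proj₂ (ends zero)
... | zero | zero = contradiction refl u≢v
det-augmentedLaplacian {suc k} {suc m} ends x w | no u≢v = begin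
  det (λ i j → A i j + + x zero * (incidence ends zero i * incidence ends zero j))
    ≡⟨ det-add-edge u v u≢v A (+ x zero) ⟩
  det A + + x zero * det (minor (congruent u v u≢v A) u u)
    ≡⟨ cong₂ (λ d e → d + + x zero * e) (det-augmentedLaplacian (ends ∘ suc) (x ∘ suc) w)
         (trans (det-cong (minor-congruent u v u≢v (ends ∘ suc) (x ∘ suc) w))
           (trans (det-augmentedLaplacian (contract u v u≢v (ends ∘ suc)) (x ∘ suc) (pushforward u v u≢v w))
             (cong (λ s → s * s * + contracted) (sum-pushforward u v u≢v w)))) ⟩
  sum w * sum w * + deleted + + x zero * (sum w * sum w * + contracted)
    ≡⟨ factor (sum w) (+ deleted) (+ x zero) (+ contracted) ⟩
  sum w * sum w * (+ deleted + + x zero * + contracted)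
    ≡⟨ cong (λ y → sum w * sum w * (+ deleted + y)) (sym (ℤₚ.pos-* (x zero) contracted)) ⟩
  sum w * sum w * + (deleted ℕ.+ x zero ℕ.* contracted) ∎
  where
  u = proj₁ (ends zero)
  v = proj₂ (ends zero)
  deleted contracted : ℕ
  deleted = treeSum (ends ∘ suc) (x ∘ suc)
  contracted = treeSum (contract u v u≢v (ends ∘ suc)) (x ∘ suc)

  A : Matrix (suc (suc k)) (suc (suc k))
  A = augmentedLaplacian (ends ∘ suc) (x ∘ suc) w

  factor : ∀ s d c e → s * s * d + c * (s * s * e) ≡ s * s * (d + c * e)
  factor = solve-∀

-- Spanning trees, contracted edge by edge

Respects : ∀ {A : Set} {m k} → Ends m k → Subset m → (Fin k → A) → Set
Respects ends T h = ∀ {e} → e ∈ T → h (proj₁ (ends e)) ≡ h (proj₂ (ends e))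

-- Connectedness tested by functions instead of walks: functions pass to and from a contraction by
-- composition with `merge` or its section. Values in `ℕ` suffice for the tests used below, `toℕ`
-- and `reach`.
Spans : ∀ {m k} → Ends m k → Subset m → Set
Spans {k = k} ends T = ∀ (h : Fin k → ℕ) → Respects ends T h → ∀ a b → h a ≡ h b

-- T is independent in the graphic matroid: every prescribed family of edge
-- differences on T comes from a potential.  Unlike the absence of cycles, this
-- passes directly to contractions.
Independent : ∀ {m k} → Ends m k → Subset m → Set
Independent {m} {k} ends T = ∀ (c : Fin m → ℤ) →
  Σ[ h ∈ (Fin k → ℤ) ] (∀ {e} → e ∈ T → h (proj₁ (ends e)) - h (proj₂ (ends e)) ≡ c e)

IsTree : ∀ {m k} → Ends m k → Subset m → Set
IsTree ends T = Spans ends T × Independent ends T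

module _ {m k} (ends : Ends (suc m) k) (T : Subset m) where

  isTree-outside⁻ : IsTree ends (outside ∷ T) → IsTree (ends ∘ suc) T
  isTree-outside⁻ (spans , independent) =
    (λ h resp → spans h λ { (there e∈T) → resp e∈T }) ,
    (λ c → let h , p = independent (λ { zero → 0ℤ ; (suc e) → c e }) in h , λ e∈T → p (there e∈T))

  isTree-outside⁺ : IsTree (ends ∘ suc) T → IsTree ends (outside ∷ T)
  isTree-outside⁺ (spans , independent) =
    (λ h resp → spans h λ e∈T → resp (there e∈T)) ,
    (λ c → let h , p = independent (c ∘ suc) in h , λ { (there e∈T) → p e∈T })

  isTree-loop : proj₁ (ends zero) ≡ proj₂ (ends zero) → ¬ IsTree ends (inside ∷ T)
  isTree-loop u≡v (_ , independent) = 0≢1 (trans (sym (ℤₚ.i≡j⇒i-j≡0 (cong h u≡v))) (p here))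
    where
    h = proj₁ (independent λ _ → 1ℤ)
    p = proj₂ (independent λ _ → 1ℤ)
    0≢1 : 0ℤ ≢ 1ℤ
    0≢1 ()

module _ {k} (u v : Fin (suc k)) (u≢v : u ≢ v) where

  merge-punchIn : ∀ i → merge u v u≢v (punchIn u i) ≡ i
  merge-punchIn i with u ≟ punchIn u i
  ... | yes u≡ = contradiction (sym u≡) (punchInᵢ≢i u i)
  ... | no u≢  = punchIn-injective u _ _ (punchIn-punchOut u≢)

  merge-≡ : merge u v u≢v u ≡ merge u v u≢v v
  merge-≡ with u ≟ u | u ≟ v
  ... | _      | yes u≡v = contradiction u≡v u≢v
  ... | no u≢u | no _    = contradiction refl u≢u
  ... | yes _  | no u≢v′ = punchIn-injective u _ _ (trans (punchIn-punchOut u≢v) (sym (punchIn-punchOut u≢v′)))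

  section-merge : ∀ {A : Set} (h : Fin (suc k) → A) → h u ≡ h v → ∀ p → h (punchIn u (merge u v u≢v p)) ≡ h p
  section-merge h hu≡hv p with u ≟ p
  ... | yes refl = trans (cong h (punchIn-punchOut u≢v)) (sym hu≡hv)
  ... | no u≢p   = cong h (punchIn-punchOut u≢p)

module _ {m k} (ends : Ends (suc m) (suc k)) (T : Subset m)
         (u≢v : proj₁ (ends zero) ≢ proj₂ (ends zero)) where
  private
    u = proj₁ (ends zero)
    v = proj₂ (ends zero)
    π = merge u v u≢v
    σ = punchIn u
    ends/e = contract u v u≢v (ends ∘ suc)

  isTree-contract⁻ : IsTree ends (inside ∷ T) → IsTree ends/e T
  isTree-contract⁻ (spans , independent) = spans′ , independent′
    where
    spans′ : Spans ends/e T
    spans′ h resp a b = trans (cong h (sym (merge-punchIn u v u≢v a))) (trans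
      (spans (h ∘ π) (λ { here → cong h (merge-≡ u v u≢v) ; (there e∈T) → resp e∈T }) (σ a) (σ b))
      (cong h (merge-punchIn u v u≢v b)))

    independent′ : Independent ends/e T
    independent′ c = h ∘ σ , λ e∈T → trans
      (cong₂ _-_ (section-merge u v u≢v h hu≡hv _) (section-merge u v u≢v h hu≡hv _)) (p (there e∈T))
      where
      c′ : Fin (suc m) → ℤ
      -- Difference 0 on the contracted edge makes the potential agree at `u` and `v`, so that it
      -- descends.
      c′ zero    = 0ℤ
      c′ (suc e) = c e
      h = proj₁ (independent c′)
      p = λ {e} → proj₂ (independent c′) {e}
      hu≡hv : h u ≡ h v
      hu≡hv = ℤₚ.i-j≡0⇒i≡j _ _ (p here)

  isTree-contract⁺ : IsTree ends/e T → IsTree ends (inside ∷ T)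
  isTree-contract⁺ (spans , independent) = spans′ , independent′
    where
    spans′ : Spans ends (inside ∷ T)
    spans′ h resp a b = trans (sym (factor a)) (trans
      (spans (h ∘ σ) (λ e∈T → trans (factor _) (trans (resp (there e∈T)) (sym (factor _)))) (π a) (π b))
      (factor b))
      where
      factor : ∀ p → h (σ (π p)) ≡ h p
      factor = section-merge u v u≢v h (resp here)

    independent′ : Independent ends (inside ∷ T)
    -- A potential pulled back along `π` has difference 0 on the edge `zero`. Adding `c zero` at `u`
    -- alone corrects this; `c′` compensates in advance for the effect on the other edges at `u`.
    independent′ c = (λ i → δ u i * c zero + h (π i)) , λ
      { {zero} here → trans
          (cong₂ (λ x y → (x * c zero + h (π u)) - (y * c zero + h (π v))) (δ-refl u) (δ-≢ u≢v))
          (trans (cong (λ p → (1ℤ * c zero + h (π u)) - (0ℤ * c zero + h p)) (sym (merge-≡ u v u≢v)))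
            (identity (c zero) (h (π u))))
      ; {suc e} (there e∈T) → trans
          (regroup (jump (proj₁ (ends (suc e)))) (h (π (proj₁ (ends (suc e)))))
                   (jump (proj₂ (ends (suc e)))) (h (π (proj₂ (ends (suc e))))))
          (trans (cong (λ d → (jump (proj₁ (ends (suc e))) - jump (proj₂ (ends (suc e)))) + d) (p e∈T))
            (complete (jump (proj₁ (ends (suc e))) - jump (proj₂ (ends (suc e)))) (c (suc e)))) }
      where
      jump : Fin (suc k) → ℤ
      jump i = δ u i * c zero
      c′ : Fin m → ℤ
      c′ e = c (suc e) - (jump (proj₁ (ends (suc e))) - jump (proj₂ (ends (suc e))))
      h = proj₁ (independent c′)
      p = λ {e} → proj₂ (independent c′) {e}

      identity : ∀ c x → (1ℤ * c + x) - (0ℤ * c + x) ≡ c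
      identity = solve-∀

      regroup : ∀ a x b y → (a + x) - (b + y) ≡ (a - b) + (x - y)
      regroup = solve-∀

      complete : ∀ j c → j + (c - j) ≡ c
      complete = solve-∀

-- The tree sum as a sum over edge subsets

edgeProduct : ∀ {m} → (Fin m → ℕ) → Subset m → ℕ
edgeProduct x []            = 1
edgeProduct x (outside ∷ T) = edgeProduct (x ∘ suc) T
edgeProduct x (inside ∷ T)  = x zero ℕ.* edgeProduct (x ∘ suc) T

sumOver : ∀ {m} {P : Subset m → Set} → (∀ T → Dec (P T)) → (Subset m → ℕ) → List (Subset m) → ℕ
sumOver P? f Ts = List.sum (map (λ T → if does (P? T) then f T else 0) Ts)

module _ {A : Set} where

  sum-map-++ : (f : A → ℕ) (xs ys : List A) →
               List.sum (map f (xs ++ ys)) ≡ List.sum (map f xs) ℕ.+ List.sum (map f ys)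
  sum-map-++ f xs ys = trans (cong List.sum (map-++ f xs ys)) (sum-++ (map f xs) (map f ys))

  sum-map-∘ : {B : Set} (f : B → ℕ) (g : A → B) (xs : List A) →
              List.sum (map f (map g xs)) ≡ List.sum (map (f ∘ g) xs)
  sum-map-∘ f g xs = cong List.sum (sym (map-∘ xs))

  sum-map-cong : {f g : A → ℕ} → f ≗ g → (xs : List A) → List.sum (map f xs) ≡ List.sum (map g xs)
  sum-map-cong f≗g xs = cong List.sum (map-cong f≗g xs)

  sum-map-0 : {f : A → ℕ} → (∀ x → f x ≡ 0) → (xs : List A) → List.sum (map f xs) ≡ 0
  sum-map-0 f≡0 []       = refl
  sum-map-0 f≡0 (x ∷ xs) = cong₂ ℕ._+_ (f≡0 x) (sum-map-0 f≡0 xs)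

  sum-map-* : ∀ c (f : A → ℕ) (xs : List A) → List.sum (map (λ x → c ℕ.* f x) xs) ≡ c ℕ.* List.sum (map f xs)
  sum-map-* c f []       = sym (ℕₚ.*-zeroʳ c)
  sum-map-* c f (x ∷ xs) = trans (cong (λ s → c ℕ.* f x ℕ.+ s) (sum-map-* c f xs)) (sym (ℕₚ.*-distribˡ-+ c (f x) _))

if-* : ∀ b c n → (if b then c ℕ.* n else 0) ≡ c ℕ.* (if b then n else 0)
if-* true  c n = refl
if-* false c n = sym (ℕₚ.*-zeroʳ c)

-- The decision procedure is arbitrary because the induction derives those of the deletion and the
-- contraction from `tree?` by `map′`, which keeps `does` and hence the summands unchanged by
-- computation.
treeSum-spec : ∀ {m k} (ends : Ends m (suc k)) x (tree? : ∀ T → Dec (IsTree ends T)) →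
               treeSum ends x ≡ sumOver tree? (edgeProduct x) (allSubsets m)
treeSum-spec {zero} {zero} ends x tree? = sym (cong (λ b → (if b then 1 else 0) ℕ.+ 0)
  (dec-true (tree? []) ((λ { h _ zero zero → refl }) , (λ c → (λ _ → 0ℤ) , λ ()))))
treeSum-spec {zero} {suc k} ends x tree? = sym (cong (λ b → (if b then 1 else 0) ℕ.+ 0)
  (dec-false (tree? []) λ (spans , _) → 0≢1 (spans toℕ (λ ()) zero (suc zero))))
  where
  0≢1 : 0 ≢ 1
  0≢1 ()
treeSum-spec {suc m} {k} ends x tree? = sym (trans
  (sum-map-++ weight (map (outside ∷_) (allSubsets m)) (map (inside ∷_) (allSubsets m)))
  (trans (cong₂ ℕ._+_ (sum-map-∘ weight (outside ∷_) (allSubsets m)) (sum-map-∘ weight (inside ∷_) (allSubsets m)))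
    split))
  where
  weight : Subset (suc m) → ℕ
  weight T = if does (tree? T) then edgeProduct x T else 0

  deleted? : ∀ T → Dec (IsTree (ends ∘ suc) T)
  deleted? T = map′ (isTree-outside⁻ ends T) (isTree-outside⁺ ends T) (tree? (outside ∷ T))

  deleted : List.sum (map (weight ∘ (outside ∷_)) (allSubsets m)) ≡ treeSum (ends ∘ suc) (x ∘ suc)
  deleted = sym (treeSum-spec (ends ∘ suc) (x ∘ suc) deleted?)

  contracted : ∀ {k} (ends : Ends (suc m) (suc k)) (tree? : ∀ T → Dec (IsTree ends T))
    (u≢v : proj₁ (ends zero) ≢ proj₂ (ends zero)) →
    List.sum (map (λ T → if does (tree? (inside ∷ T)) then x zero ℕ.* edgeProduct (x ∘ suc) T else 0) (allSubsets m)) ≡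
    x zero ℕ.* treeSum (contract _ _ u≢v (ends ∘ suc)) (x ∘ suc)
  contracted {zero} ends tree? u≢v with proj₁ (ends zero) | proj₂ (ends zero)
  ... | zero | zero = contradiction refl u≢v
  contracted {suc k} ends tree? u≢v = trans
    (sum-map-cong (λ T → if-* (does (tree? (inside ∷ T))) (x zero) (edgeProduct (x ∘ suc) T)) (allSubsets m))
    (trans (sum-map-* (x zero) (λ T → if does (tree? (inside ∷ T)) then edgeProduct (x ∘ suc) T else 0) (allSubsets m))
      (cong (x zero ℕ.*_) (sym (treeSum-spec (contract _ _ u≢v (ends ∘ suc)) (x ∘ suc) contracted?))))
    where
    contracted? : ∀ T → Dec (IsTree (contract _ _ u≢v (ends ∘ suc)) T)
    contracted? T = map′ (isTree-contract⁻ ends T u≢v) (isTree-contract⁺ ends T u≢v) (tree? (inside ∷ T))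

  split : List.sum (map (weight ∘ (outside ∷_)) (allSubsets m)) ℕ.+
          List.sum (map (weight ∘ (inside ∷_)) (allSubsets m)) ≡ treeSum ends x
  split with proj₁ (ends zero) ≟ proj₂ (ends zero)
  ... | yes u≡v = trans (cong₂ ℕ._+_ deleted (sum-map-0 (λ T → cong (if_then edgeProduct x (inside ∷ T) else 0)
                    (dec-false (tree? (inside ∷ T)) (isTree-loop ends T u≡v))) (allSubsets m)))
                    (ℕₚ.+-identityʳ _)
  ... | no u≢v = cong₂ ℕ._+_ deleted (contracted ends tree? u≢v)

treeSum-⇔ : ∀ {m k} .{{_ : NonZero k}} (ends : Ends m k) x {P : Subset m → Set} →
            (∀ T → P T ⇔ IsTree ends T) → (P? : ∀ T → Dec (P T)) →
            treeSum ends x ≡ sumOver P? (edgeProduct x) (allSubsets m)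
treeSum-⇔ {k = suc _} ends x P⇔tree P? = treeSum-spec ends x λ T → Dec.map (P⇔tree T) (P? T)

-- Deleting an edge may disconnect the graph, but contracting one cannot: at a non-loop the
-- contracted term alone is already positive.
treeSum>0 : ∀ {m k} (ends : Ends m (suc k)) x → (∀ e → 0 < x e) → Spans ends ⊤ → 0 < treeSum ends x
treeSum>0 {zero} {zero}  ends x x>0 spans = ℕ.s≤s ℕ.z≤n
treeSum>0 {zero} {suc k} ends x x>0 spans = contradiction (spans toℕ (λ ()) zero (suc zero)) λ ()
treeSum>0 {suc m} {k} ends x x>0 spans with proj₁ (ends zero) ≟ proj₂ (ends zero)
... | yes u≡v = treeSum>0 (ends ∘ suc) (x ∘ suc) (x>0 ∘ suc)
    λ h resp → spans h λ { {zero} _ → cong h u≡v ; {suc e} (there e∈) → resp e∈ }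
treeSum>0 {suc m} {zero} ends x x>0 spans | no u≢v with proj₁ (ends zero) | proj₂ (ends zero)
... | zero | zero = contradiction refl u≢v
treeSum>0 {suc m} {suc k} ends x x>0 spans | no u≢v =
  ℕₚ.<-≤-trans (ℕₚ.*-mono-≤ (x>0 zero) (treeSum>0 (contract _ _ u≢v (ends ∘ suc)) (x ∘ suc) (x>0 ∘ suc) spans′))
    (ℕₚ.m≤n+m _ _)
  where
  spans′ : Spans (contract _ _ u≢v (ends ∘ suc)) ⊤
  spans′ h resp a b = trans (cong h (sym (merge-punchIn _ _ u≢v a))) (trans
    (spans (h ∘ merge _ _ u≢v)
      (λ { {zero} _ → cong h (merge-≡ _ _ u≢v) ; {suc e} (there e∈) → resp e∈ }) _ _)
    (cong h (merge-punchIn _ _ u≢v b)))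

-- Spanning trees in terms of walks

-- Otherwise removing `x` a second time would lower the size, yet removal is idempotent.
x∉p∖x : ∀ {m} (p : Subset m) x → x ∉ p ∖ x
x∉p∖x p x x∈ = ℕₚ.<-irrefl (cong size (p─q─q≡p─q p ⁅ x ⁆)) (x∈p⇒∣p-x∣<∣p∣ x∈)

∉⇒Unique-∷ : ∀ {A : Set} {x : A} {xs} → x ∉ₗ xs → Unique xs → Unique (x ∷ xs)
∉⇒Unique-∷ x∉xs xs! = All.tabulate (λ y∈xs x≡y → x∉xs (subst (_∈ₗ _) (sym x≡y) y∈xs)) ∷ xs!

head∉tail : ∀ {A : Set} {x : A} {xs} → Unique (x ∷ xs) → x ∉ₗ xs
head∉tail (x≢ ∷ _) x∈xs = All.lookup x≢ x∈xs refl

module _ {n} (G : Multigraph n) where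
  open Multigraph G

  joins-respects : ∀ {A : Set} {T : Subset #edges} {h : Fin n → A} → Respects ends T h →
                   ∀ {e u v} → e ∈ T → Joins G e u v → h u ≡ h v
  joins-respects {h = h} resp e∈T (inj₁ eq) = trans (cong (h ∘ proj₁) (sym eq)) (trans (resp e∈T) (cong (h ∘ proj₂) eq))
  joins-respects {h = h} resp e∈T (inj₂ eq) = trans (cong (h ∘ proj₂) (sym eq)) (trans (sym (resp e∈T)) (cong (h ∘ proj₁) eq))

  joins-ends : ∀ e → Joins G e (proj₁ (ends e)) (proj₂ (ends e))
  joins-ends e = inj₁ refl

  joins-endpoint : ∀ {e a b u v} → Joins G e a b → Joins G e u v → u ≡ a ⊎ u ≡ b
  joins-endpoint (inj₁ p) (inj₁ q) = inj₁ (cong proj₁ (trans (sym q) p))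
  joins-endpoint (inj₁ p) (inj₂ q) = inj₂ (cong proj₂ (trans (sym q) p))
  joins-endpoint (inj₂ p) (inj₁ q) = inj₂ (cong proj₁ (trans (sym q) p))
  joins-endpoint (inj₂ p) (inj₂ q) = inj₁ (cong proj₂ (trans (sym q) p))

  walk-respects : ∀ {A : Set} {T} {h : Fin n → A} → Respects ends T h → ∀ {u v} → Walk G T u v → h u ≡ h v
  walk-respects resp []               = refl
  walk-respects {h = h} resp (step e e∈T j c) = trans (joins-respects {h = h} resp e∈T j) (walk-respects resp c)

  weaken : ∀ {T T′} → T ⊆ T′ → ∀ {u v} → Walk G T u v → Walk G T′ u v
  weaken T⊆T′ []               = []
  weaken T⊆T′ (step e e∈T j c) = step e (T⊆T′ e∈T) j (weaken T⊆T′ c)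

  edges-weaken : ∀ {T T′} (T⊆T′ : T ⊆ T′) {u v} (c : Walk G T u v) → edges G (weaken T⊆T′ c) ≡ edges G c
  edges-weaken T⊆T′ []               = refl
  edges-weaken T⊆T′ (step e e∈T j c) = cong (e ∷_) (edges-weaken T⊆T′ c)

  vertices-weaken : ∀ {T T′} (T⊆T′ : T ⊆ T′) {u v} (c : Walk G T u v) → vertices G (weaken T⊆T′ c) ≡ vertices G c
  vertices-weaken T⊆T′ []                 = refl
  vertices-weaken T⊆T′ (step {u} e e∈T j c) = cong (u ∷_) (vertices-weaken T⊆T′ c)

  edges⊆ : ∀ {T u v} (c : Walk G T u v) {e} → e ∈ₗ edges G c → e ∈ T
  edges⊆ (step e e∈T j c) (here refl) = e∈T
  edges⊆ (step e e∈T j c) (there e∈c) = edges⊆ c e∈c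

  _⟶?_ : ∀ {T} u v → Dec (Walk G T u v)
  u ⟶? v = map′ proj₁ (simplify G) (walk? G u v (λ _ vs → DecUnique.unique? _≟_ vs) id)

  -- The indicator of the component of `u`. It respects the edges of `T`, so a spanning `T` forces
  -- it to be constantly 1.
  reach : Subset #edges → Fin n → Fin n → ℕ
  reach T u v = if does (_⟶?_ {T} u v) then 1 else 0

  reach-yes : ∀ {T u v} → Walk G T u v → reach T u v ≡ 1
  reach-yes {T} {u} {v} c = cong (if_then 1 else 0) (dec-true (u ⟶? v) c)

  reach-no : ∀ {T u v} → ¬ Walk G T u v → reach T u v ≡ 0
  reach-no {T} {u} {v} ¬c = cong (if_then 1 else 0) (dec-false (u ⟶? v) ¬c)

  snoc : ∀ {T u v w e} → Walk G T u v → e ∈ T → Joins G e v w → Walk G T u w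
  snoc []                 e∈T j = step _ e∈T j []
  snoc (step f f∈T j′ c) e∈T j = step f f∈T j′ (snoc c e∈T j)

  reach-respects : ∀ T u → Respects ends T (reach T u)
  reach-respects T u {e} e∈T = decide (u ⟶? proj₁ (ends e))
    where
    decide : Dec (Walk G T u (proj₁ (ends e))) → reach T u (proj₁ (ends e)) ≡ reach T u (proj₂ (ends e))
    decide (yes c) = trans (reach-yes c) (sym (reach-yes (snoc c e∈T (joins-ends e))))
    decide (no ¬c) = trans (reach-no ¬c) (sym (reach-no λ c → ¬c (snoc c e∈T (inj₂ refl))))

  connected⇒spans : ∀ {T} → Connected G T → Spans ends T
  connected⇒spans conn h resp a b = walk-respects resp (conn a b)

  spans⇒connected : ∀ {T} → Spans ends T → Connected G T
  spans⇒connected {T} spans u v = decide (u ⟶? v)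
    where
    decide : Dec (Walk G T u v) → Walk G T u v
    decide (yes c) = c
    decide (no ¬c) = contradiction
      (trans (sym (reach-yes {T} {u} [])) (trans (spans (reach T u) (reach-respects T u) u v) (reach-no ¬c))) λ ()

  -- Prescribe difference 1 on the first edge of the cycle and 0 on the others. The rest of the
  -- cycle avoids that edge, so the potential is constant along it and the two ends of the first
  -- edge get equal values.
  independent⇒acyclic : ∀ {T} → Independent ends T → Acyclic G T
  independent⇒acyclic independent [] (nonempty , _) = nonempty refl
  independent⇒acyclic {T} independent {u} (step {v = v} e e∈T j c) (_ , e! , _) =
    contradiction (trans (sym (p e∈T)) (ℤₚ.i≡j⇒i-j≡0 (joined j (sym (constant c (head∉tail e!))))))
      (λ δ≡0 → 1≢0 (trans (sym (δ-refl e)) δ≡0))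
    where
    h = proj₁ (independent (δ e))
    p = λ {e′} → proj₂ (independent (δ e)) {e′}

    1≢0 : 1ℤ ≢ 0ℤ
    1≢0 ()

    joined : ∀ {a b} → Joins G e a b → h a ≡ h b → h (proj₁ (ends e)) ≡ h (proj₂ (ends e))
    joined (inj₁ eq) ha≡hb = trans (cong (h ∘ proj₁) eq) (trans ha≡hb (cong (h ∘ proj₂) (sym eq)))
    joined (inj₂ eq) ha≡hb = trans (cong (h ∘ proj₁) eq) (trans (sym ha≡hb) (cong (h ∘ proj₂) (sym eq)))

    constant : ∀ {a b} (c : Walk G T a b) → e ∉ₗ edges G c → h a ≡ h b
    constant []                 e∉ = refl
    constant (step f f∈T j c) e∉ = trans
      -- The potential respects `f` but possibly not all of `T`, hence the singleton.
      (joins-respects {T = ⁅ f ⁆} {h = h} (λ { {f′} f′∈ → subst (λ f → h (proj₁ (ends f)) ≡ h (proj₂ (ends f)))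
         (sym (x∈⁅y⁆⇒x≡y f f′∈)) (ℤₚ.i-j≡0⇒i≡j _ _ (trans (p f∈T) (δ-≢ (e∉ ∘ here)))) }) (x∈⁅x⁆ f) j)
      (constant c (e∉ ∘ there))

  -- Defs.simplify leaves open whether the final vertex of a walk is visited
  -- before; cutting at its first visit makes all vertices distinct.
  simplePath : ∀ {T u w} (c : Walk G T u w) → Unique (vertices G c) →
               Σ[ p ∈ Walk G T u w ] Unique (vertices G p) × w ∉ₗ vertices G p ×
                 (∀ {v} → v ∈ₗ vertices G p → v ∈ₗ vertices G c)
  simplePath [] [] = [] , [] , (λ ()) , id
  simplePath {w = w} (step {u = u} e e∈T j c) u∷c!@(_ ∷ c!) with u ≟ w
  ... | yes refl = [] , [] , (λ ()) , λ ()
  ... | no u≢w =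
    let p , p! , w∉p , p⊆c = simplePath c c! in
    step e e∈T j p , ∉⇒Unique-∷ (head∉tail u∷c! ∘ p⊆c) p! ,
    (λ { (here w≡u) → u≢w (sym w≡u) ; (there w∈p) → w∉p w∈p }) ,
    (λ { (here refl) → here refl ; (there v∈p) → there (p⊆c v∈p) })

  -- The second alternative is the final vertex, which `vertices` omits.
  endpoint-visited : ∀ {T a b} (c : Walk G T a b) {e u v} → e ∈ₗ edges G c → Joins G e u v →
                     u ∈ₗ vertices G c ⊎ u ≡ b
  endpoint-visited (step {u = x} {v = y} e e∈T j c) (here refl) j′ with joins-endpoint j j′
  ... | inj₁ refl = inj₁ (here refl)
  ... | inj₂ refl with c
  ...   | []              = inj₂ refl
  ...   | step _ _ _ _    = inj₁ (there (here refl))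
  endpoint-visited (step e e∈T j c) (there e∈c) j′ with endpoint-visited c e∈c j′
  ... | inj₁ u∈c = inj₁ (there u∈c)
  ... | inj₂ u≡b = inj₂ u≡b

  -- Meeting the first edge again would mean meeting its starting vertex again.
  simplePath-edges! : ∀ {T u w} (p : Walk G T u w) → Unique (vertices G p) → w ∉ₗ vertices G p → Unique (edges G p)
  simplePath-edges! [] _ _ = []
  simplePath-edges! (step {u = u} e e∈T j c) u∷c!@(_ ∷ c!) w∉ = ∉⇒Unique-∷ e∉c (simplePath-edges! c c! (w∉ ∘ there))
    where
    e∉c : e ∉ₗ edges G c
    e∉c e∈c with endpoint-visited c e∈c j
    ... | inj₁ u∈c = head∉tail u∷c! u∈c
    ... | inj₂ u≡w = w∉ (here (sym u≡w))

  ∖⊆ : ∀ (T : Subset #edges) e → T ∖ e ⊆ T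
  ∖⊆ T e = p─q⊆p T ⁅ e ⁆

  -- A walk back to `u` that avoids `e`, once cut down to a simple path, is closed by `e` into a
  -- cycle.
  acyclic⇒bridge : ∀ {T} → Acyclic G T → ∀ {e u v} → e ∈ T → Joins G e u v → ¬ Walk G (T ∖ e) v u
  acyclic⇒bridge {T} acyclic {e} {u} {v} e∈T j c =
    acyclic (step e e∈T j q) ((λ ()) ,
      ∉⇒Unique-∷ (subst (e ∉ₗ_) (sym edges≡) (x∉p∖x T e ∘ edges⊆ p)) (subst Unique (sym edges≡) (simplePath-edges! p p! u∉p)) ,
      ∉⇒Unique-∷ (subst (u ∉ₗ_) (sym vertices≡) u∉p) (subst Unique (sym vertices≡) p!))
    where
    simple = simplify G c
    path = simplePath (proj₁ simple) (proj₂ simple)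
    p = proj₁ path
    p! = proj₁ (proj₂ path)
    u∉p = proj₁ (proj₂ (proj₂ path))
    q = weaken (∖⊆ T e) p
    edges≡ = edges-weaken (∖⊆ T e) p
    vertices≡ = vertices-weaken (∖⊆ T e) p

  acyclic-⊆ : ∀ {T T′} → T ⊆ T′ → Acyclic G T′ → Acyclic G T
  acyclic-⊆ T⊆T′ acyclic c (nonempty , e! , v!) = acyclic (weaken T⊆T′ c)
    ( (λ eq → nonempty (trans (sym (edges-weaken T⊆T′ c)) eq))
    , subst Unique (sym (edges-weaken T⊆T′ c)) e!
    , subst Unique (sym (vertices-weaken T⊆T′ c)) v!)

  acyclic⇒independent : ∀ {T} → Acyclic G T → Independent ends T
  acyclic⇒independent {T} = go T (<-wellFounded (size T))
    where
    -- Removing an edge e = uv disconnects u from v, so the potential of the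
    -- other edges may be shifted on the component of v.
    go : ∀ T → Acc _<_ (size T) → Acyclic G T → Independent ends T
    go T (acc rec) acyclic c with nonempty? T
    ... | no empty = (λ _ → 0ℤ) , λ e∈T → contradiction (_ , e∈T) empty
    ... | yes (e , e∈T) = h′ , λ {f} f∈T → difference f f∈T (f ≟ e)
      where
      u = proj₁ (ends e)
      v = proj₂ (ends e)
      potential = go (T ∖ e) (rec (x∈p⇒∣p-x∣<∣p∣ e∈T)) (acyclic-⊆ (∖⊆ T e) acyclic) c
      h = proj₁ potential
      χ = reach (T ∖ e) v
      -- The error of the smaller potential at `e`. Since `χ` is 1 at `v` and 0 at `u`, adding `t`
      -- on the component of `v` cancels it.
      t = h u - h v - c e
      h′ : Fin n → ℤ
      h′ i = h i + + χ i * t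

      at-e : ∀ a b c → (a + 0ℤ * (a - b - c)) - (b + 1ℤ * (a - b - c)) ≡ c
      at-e = solve-∀

      off-e : ∀ a b x t → (a + x * t) - (b + x * t) ≡ a - b
      off-e = solve-∀

      difference : ∀ f → f ∈ T → Dec (f ≡ e) → h′ (proj₁ (ends f)) - h′ (proj₂ (ends f)) ≡ c f
      difference f f∈T (yes refl) = trans
        (cong₂ (λ x y → (h u + + x * t) - (h v + + y * t))
          (reach-no (acyclic⇒bridge acyclic e∈T (joins-ends e))) (reach-yes {T ∖ e} {v} []))
        (at-e (h u) (h v) (c e))
      difference f f∈T (no f≢e) = trans
        (cong (λ x → (h (proj₁ (ends f)) + + x * t) - (h (proj₂ (ends f)) + + χ (proj₂ (ends f)) * t))
          (reach-respects (T ∖ e) v f∈T∖e))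
        (trans (off-e (h (proj₁ (ends f))) (h (proj₂ (ends f))) (+ χ (proj₂ (ends f))) t)
          (proj₂ potential f∈T∖e))
        where
        f∈T∖e : f ∈ T ∖ e
        f∈T∖e = x∈p∧x≢y⇒x∈p-y f∈T f≢e

  spanningTree⇔isTree : ∀ T → IsSpanningTree G T ⇔ IsTree ends T
  spanningTree⇔isTree T = mk⇔
    (λ (conn , acyclic) → connected⇒spans conn , acyclic⇒independent acyclic)
    (λ (spans , independent) → spans⇒connected spans , independent⇒acyclic independent)

-- The critical group of an arithmetical structure

indicator : ∀ {P : Set} → Dec P → ℕ
indicator P? = if does P? then 1 else 0

length-filter-tabulate : ∀ {m} {A : Set} {P : A → Set} (P? : ∀ x → Dec (P x)) (f : Fin m → A) →
  length (filter P? (tabulate f)) ≡ sumℕ (λ i → indicator (P? (f i)))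
length-filter-tabulate {zero}  P? f = refl
length-filter-tabulate {suc m} P? f with does (P? (f zero))
... | true  = cong suc (length-filter-tabulate P? (f ∘ suc))
... | false = length-filter-tabulate P? (f ∘ suc)

pos-sum : ∀ {m} (f : Fin m → ℕ) → + sumℕ f ≡ sum (λ i → + f i)
pos-sum {zero}  f = refl
pos-sum {suc m} f = trans (ℤₚ.pos-+ (f zero) _) (cong (λ s → + f zero + s) (pos-sum (f ∘ suc)))

infix 8 _·_

_·_ : ∀ {n} → (Fin n → ℤ) → (Fin n → ℤ) → ℤ
a · b = sum (λ i → a i * b i)

·-linear : ∀ {n} (a b b′ : Fin n → ℤ) c → a · (λ i → b i + c * b′ i) ≡ a · b + c * a · b′
·-linear a b b′ c = trans (sum-cong-≗ λ i → expand (a i) (b i) c (b′ i))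
  (sum-linear (λ i → a i * b i) (λ i → a i * b′ i) c)
  where
  expand : ∀ a b c d → a * (b + c * d) ≡ a * b + c * (a * d)
  expand = solve-∀

·-scale : ∀ {n} (a b : Fin n → ℤ) c → a · (λ i → c * b i) ≡ c * a · b
·-scale a b c = trans (sum-cong-≗ λ i → shuffle (a i) c (b i)) (sym (*-distribˡ-sum c (λ i → a i * b i)))
  where
  shuffle : ∀ a c b → a * (c * b) ≡ c * (a * b)
  shuffle = solve-∀

·-congʳ : ∀ {n} (a : Fin n → ℤ) {b b′ : Fin n → ℤ} → b ≗ b′ → a · b ≡ a · b′
·-congʳ a b≗b′ = sum-cong-≗ λ i → cong (a i *_) (b≗b′ i)

·-comm : ∀ {n} (a b : Fin n → ℤ) → a · b ≡ b · a
·-comm a b = sum-cong-≗ λ i → ℤₚ.*-comm (a i) (b i)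

bézout : ∀ a b → Σ[ s ∈ ℤ ] Σ[ t ∈ ℤ ] + a * s + + b * t ≡ + gcd a b
bézout a b with Bézout.identity (gcd-GCD a b)
... | Bézout.+- x y d+yb≡xa = + x , - + y , (begin
    + a * + x + + b * - + y     ≡⟨ cong (λ z → z + + b * - + y) (trans (ℤₚ.*-comm (+ a) (+ x)) (sym (ℤₚ.pos-* x a))) ⟩
    + (x ℕ.* a) + + b * - + y   ≡⟨ cong (λ z → + z + + b * - + y) (sym d+yb≡xa) ⟩
    + (gcd a b ℕ.+ y ℕ.* b) + + b * - + y ≡⟨ cong (λ z → z + + b * - + y) (trans (ℤₚ.pos-+ (gcd a b) _) (cong (λ z → + gcd a b + z) (ℤₚ.pos-* y b))) ⟩
    (+ gcd a b + + y * + b) + + b * - + y ≡⟨ cancel (+ gcd a b) (+ y) (+ b) ⟩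
    + gcd a b ∎)
  where
  cancel : ∀ d y b → (d + y * b) + b * - y ≡ d
  cancel = solve-∀
... | Bézout.-+ x y d+xa≡yb = - + x , + y , (begin
    + a * - + x + + b * + y     ≡⟨ cong (λ z → + a * - + x + z) (trans (ℤₚ.*-comm (+ b) (+ y)) (sym (ℤₚ.pos-* y b))) ⟩
    + a * - + x + + (y ℕ.* b)   ≡⟨ cong (λ z → + a * - + x + + z) (sym d+xa≡yb) ⟩
    + a * - + x + + (gcd a b ℕ.+ x ℕ.* a) ≡⟨ cong (λ z → + a * - + x + z) (trans (ℤₚ.pos-+ (gcd a b) _) (cong (λ z → + gcd a b + z) (ℤₚ.pos-* x a))) ⟩
    + a * - + x + (+ gcd a b + + x * + a) ≡⟨ cancel (+ gcd a b) (+ x) (+ a) ⟩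
    + gcd a b ∎)
  where
  cancel : ∀ d x a → a * - x + (d + x * a) ≡ d
  cancel = solve-∀

bézoutVector : ∀ {n} (r : Fin n → ℕ) → Σ[ v ∈ (Fin n → ℤ) ] (+_ ∘ r) · v ≡ + Vector.foldr gcd 0 r
bézoutVector {zero}  r = (λ ()) , refl
bézoutVector {suc n} r =
  let v , p = bézoutVector (r ∘ suc)
      s , t , q = bézout (r zero) (Vector.foldr gcd 0 (r ∘ suc))
  in (λ { zero → s ; (suc i) → t * v i }) ,
     trans (cong (λ z → + r zero * s + z) (trans (·-scale (+_ ∘ r ∘ suc) v t)
       (trans (ℤₚ.*-comm t _) (cong (_* t) p)))) q

torsion-multiple : ∀ {n} (L : Matrix n n) k x i →
  CommutativeMonoidMult._×_ (AbelianGroup.commutativeMonoid (cokernel L)) k x i ≡ + k * x i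
torsion-multiple L zero    x i = sym (ℤₚ.*-zeroˡ (x i))
torsion-multiple L (suc k) x i = trans (cong (λ z → x i + z) (torsion-multiple L k x i)) (distribute (+ k) (x i))
  where
  distribute : ∀ k x → x + k * x ≡ (1ℤ + k) * x
  distribute = solve-∀

bordered : ∀ {n} → Matrix n n → (Fin n → ℤ) → Matrix n n
bordered L v i j = L i j + v i * v j

-- For symmetric L with L r = 0 and r · v = 1 the matrix N = L + v vᵀ satisfies
-- N r = v, so its image is the image of L plus ℤ v, while ℤⁿ is the direct sum
-- of r^⊥ ⊇ im L and ℤ v.  Hence coker N is r^⊥ / im L, which is the torsion of
-- coker L.
module _ {n} (L : Matrix n n) (L-sym : ∀ i j → L i j ≡ L j i) (r v : Fin n → ℤ)
         (Lr≡0 : ∀ i → (L *ᵥ r) i ≡ 0ℤ) (r·v≡1 : r · v ≡ 1ℤ) where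

  private
    N = bordered L v

  r·L≡0 : ∀ y → r · (L *ᵥ y) ≡ 0ℤ
  r·L≡0 y = begin
    (sum λ i → r i * (sum λ j → L i j * y j))   ≡⟨ sum-cong-≗ (λ i → *-distribˡ-sum (r i) (λ j → L i j * y j)) ⟩
    (sum λ i → sum λ j → r i * (L i j * y j))   ≡⟨ ∑-comm (λ i j → r i * (L i j * y j)) ⟩
    (sum λ j → sum λ i → r i * (L i j * y j))   ≡⟨ sum-cong-≗ (λ j → trans
      (sum-cong-≗ λ i → trans (cong (λ l → r i * (l * y j)) (L-sym i j)) (shuffle (r i) (L j i) (y j)))
      (sym (*-distribˡ-sum (y j) (λ i → L j i * r i)))) ⟩
    (sum λ j → y j * (L *ᵥ r) j)                ≡⟨ sum-≡0 (λ j → trans (cong (y j *_) (Lr≡0 j)) (ℤₚ.*-zeroʳ (y j))) ⟩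
    0ℤ ∎
    where
    shuffle : ∀ r l y → r * (l * y) ≡ y * (l * r)
    shuffle = solve-∀

  N*ᵥ : ∀ y i → (N *ᵥ y) i ≡ (L *ᵥ y) i + v · y * v i
  N*ᵥ y i = trans (sum-cong-≗ λ j → expand (L i j) (v i) (v j) (y j))
    (trans (sum-linear (λ j → L i j * y j) (λ j → v j * y j) (v i))
      (cong (λ z → (L *ᵥ y) i + z) (ℤₚ.*-comm (v i) (v · y))))
    where
    expand : ∀ l a b y → (l + a * b) * y ≡ l * y + a * (b * y)
    expand = solve-∀

  -- Pairing with `r` kills the image of `L` and reads off the coefficient of `v`.
  r·N*ᵥ : ∀ y → r · (N *ᵥ y) ≡ v · y
  r·N*ᵥ y = begin
    r · (N *ᵥ y)                               ≡⟨ ·-congʳ r (N*ᵥ y) ⟩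
    r · (λ i → (L *ᵥ y) i + v · y * v i)       ≡⟨ ·-linear r (L *ᵥ y) v (v · y) ⟩
    r · (L *ᵥ y) + v · y * r · v               ≡⟨ cong₂ (λ a b → a + v · y * b) (r·L≡0 y) r·v≡1 ⟩
    0ℤ + v · y * 1ℤ                            ≡⟨ identity (v · y) ⟩
    v · y                                      ∎
    where
    identity : ∀ x → 0ℤ + x * 1ℤ ≡ x
    identity = solve-∀

  torsion⇒⊥ : ∀ x → IsTorsion (cokernel L) x → r · x ≡ 0ℤ
  torsion⇒⊥ x (suc k , _ , (y , p)) with ℤₚ.i*j≡0⇒i≡0∨j≡0 (+ suc k) (begin
    + suc k * r · x             ≡⟨ sym (·-scale r x (+ suc k)) ⟩
    r · (λ i → + suc k * x i)   ≡⟨ ·-congʳ r (λ i → trans (sym (torsion-multiple L (suc k) x i)) (trans (sym (ℤₚ.+-identityʳ _)) (p i))) ⟩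
    r · (L *ᵥ y)                ≡⟨ r·L≡0 y ⟩
    0ℤ ∎)
  ... | inj₂ r·x≡0 = r·x≡0

  -- A relation `K x = N y` paired with `r` gives `v · y = 0`, and on such `y` the matrices `N` and
  -- `L` agree.
  ⊥⇒torsion : (∀ x → TorsionModImage N x) → ∀ x → r · x ≡ 0ℤ → IsTorsion (cokernel L) x
  ⊥⇒torsion torsion x r·x≡0 with torsion x
  ... | K , K≢0 , y , p = abs K K≢0 multiple
    where
    v·y≡0 : v · y ≡ 0ℤ
    v·y≡0 = begin
      v · y                   ≡⟨ sym (r·N*ᵥ y) ⟩
      r · (N *ᵥ y)            ≡⟨ ·-congʳ r (λ i → sym (p i)) ⟩
      r · (λ i → K * x i)     ≡⟨ ·-scale r x K ⟩
      K * r · x               ≡⟨ cong (K *_) r·x≡0 ⟩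
      K * 0ℤ                  ≡⟨ ℤₚ.*-zeroʳ K ⟩
      0ℤ ∎

    multiple : ∀ i → K * x i ≡ (L *ᵥ y) i
    multiple i = trans (p i) (trans (N*ᵥ y i)
      (trans (cong (λ z → (L *ᵥ y) i + z * v i) v·y≡0) (identity ((L *ᵥ y) i) (v i))))
      where
      identity : ∀ x y → x + 0ℤ * y ≡ x
      identity = solve-∀

    abs : ∀ K → K ≢ 0ℤ → (∀ i → K * x i ≡ (L *ᵥ y) i) → IsTorsion (cokernel L) x
    abs (+ zero)  K≢0 q = contradiction refl K≢0
    abs (+ suc k) K≢0 q = suc k , _ , (y , λ i → trans (ℤₚ.+-identityʳ _) (trans (torsion-multiple L (suc k) x i) (q i)))
    abs -[1+ k ]  K≢0 q = suc k , _ , ((λ j → - y j) , λ i → trans (ℤₚ.+-identityʳ _)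
      (trans (torsion-multiple L (suc k) x i)
        (trans (trans (neg (-[1+ k ]) (x i)) (cong -_ (q i))) (sym (*ᵥ-neg L y i)))))
      where
      neg : ∀ k x → - k * x ≡ - (k * x)
      neg = solve-∀

  -- Representatives are projected along `v` onto the complement of `r`. Because `v = N r` lies in
  -- the image of `N`, the projection does not change their class modulo that image.
  hasOrder : ∀ {k} → Transversal (bordered L v) k → HasOrder (torsionSubgroup (cokernel L)) k
  hasOrder {k} T = record
    { to        = λ i → projected i , ⊥⇒torsion torsion (projected i) (projected-⊥ i)
    ; cong      = λ { {i} refl → AbelianGroup.refl (cokernel L) {projected i} }
    ; bijective = (λ {i} {j} → injective i j) , λ { (x , tors) → let i , p = surjective x tors in i , λ { refl → p } }
    }
    where
    open Transversal T

    height : Fin k → ℤ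
    height i = r · rep i

    projected : Fin k → Fin n → ℤ
    projected i k = rep i k + - height i * v k

    projected-⊥ : ∀ i → r · projected i ≡ 0ℤ
    projected-⊥ i = trans (·-linear r (rep i) v (- height i))
      (trans (cong (λ z → height i + - height i * z) r·v≡1) (identity (height i)))
      where
      identity : ∀ h → h + - h * 1ℤ ≡ 0ℤ
      identity = solve-∀

    injective : ∀ i j → _≡_modImage L (projected i) (projected j) → i ≡ j
    injective i j (u , p) = distinct (y , λ k → begin
      rep i k - rep j k
        ≡⟨ separate (rep i k) (rep j k) (height i) (height j) (v k) ⟩
      (projected i k - projected j k) + (height i - height j) * v k
        ≡⟨ cong₂ (λ a b → a + b * v k) (trans (p k) (sym (Ly≡Lu k))) (sym v·y≡) ⟩
      (L *ᵥ y) k + v · y * v k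
        ≡⟨ sym (N*ᵥ y k) ⟩
      (N *ᵥ y) k ∎)
      where
      c : ℤ
      -- Adding a multiple of `r` changes `v · u` freely without changing `L u`; this multiple makes
      -- `v · y` the difference of heights, which is the coefficient of `v` needed for `N y`.
      c = height i - height j - v · u

      y : Fin n → ℤ
      y k = u k + c * r k

      separate : ∀ a b h k v → a - b ≡ ((a + - h * v) - (b + - k * v)) + (h - k) * v
      separate = solve-∀

      Ly≡Lu : ∀ k → (L *ᵥ y) k ≡ (L *ᵥ u) k
      Ly≡Lu k = trans (·-linear (L k) u r c) (trans (cong (λ z → (L *ᵥ u) k + c * z) (Lr≡0 k))
        (identity ((L *ᵥ u) k) c))
        where
        identity : ∀ x c → x + c * 0ℤ ≡ x
        identity = solve-∀

      v·y≡ : v · y ≡ height i - height j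
      v·y≡ = trans (·-linear v u r c) (trans (cong (λ z → v · u + c * z) (trans (·-comm v r) r·v≡1))
        (identity (v · u) (height i - height j)))
        where
        identity : ∀ x d → x + (d - x) * 1ℤ ≡ d
        identity = solve-∀

    surjective : ∀ x → IsTorsion (cokernel L) x → Σ[ i ∈ Fin k ] _≡_modImage L (projected i) x
    surjective x tors with complete x
    ... | i , (y , p) = i , (y , λ k → begin
      projected i k - x k                          ≡⟨ regroup (rep i k) (height i) (v k) (x k) ⟩
      (rep i k - x k) + - height i * v k           ≡⟨ cong₂ (λ a h → a + - h * v k) (trans (p k) (N*ᵥ y k)) height≡ ⟩
      (L *ᵥ y) k + v · y * v k + - (v · y) * v k     ≡⟨ cancel ((L *ᵥ y) k) (v · y) (v k) ⟩
      (L *ᵥ y) k                                   ∎)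
      where
      regroup : ∀ a h v x → (a + - h * v) - x ≡ (a - x) + - h * v
      regroup = solve-∀

      cancel : ∀ l d v → l + d * v + - d * v ≡ l
      cancel = solve-∀

      height≡ : height i ≡ v · y
      height≡ = begin
        r · rep i                              ≡⟨ add0 (r · rep i) ⟩
        r · rep i + - 1ℤ * 0ℤ                  ≡⟨ cong (λ z → r · rep i + - 1ℤ * z) (sym (torsion⇒⊥ x tors)) ⟩
        r · rep i + - 1ℤ * r · x               ≡⟨ sym (·-linear r (rep i) x (- 1ℤ)) ⟩
        r · (λ k → rep i k + - 1ℤ * x k)       ≡⟨ ·-congʳ r (λ k → trans (minus (rep i k) (x k)) (p k)) ⟩
        r · (N *ᵥ y)                           ≡⟨ r·N*ᵥ y ⟩
        v · y                                  ∎
        where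
        add0 : ∀ h → h ≡ h + - 1ℤ * 0ℤ
        add0 = solve-∀
        minus : ∀ a x → a + - 1ℤ * x ≡ a - x
        minus = solve-∀

-- The scaled Laplacian as a sum over edges

augmentedLaplacian-sum : ∀ {m k} (ends : Ends m k) x w i j →
  augmentedLaplacian ends x w i j ≡
  w i * w j + sum (λ e → + x e * (incidence ends e i * incidence ends e j))
augmentedLaplacian-sum {zero}  ends x w i j = sym (ℤₚ.+-identityʳ (w i * w j))
augmentedLaplacian-sum {suc m} ends x w i j = trans
  (cong (λ z → z + + x zero * (incidence ends zero i * incidence ends zero j))
    (augmentedLaplacian-sum (ends ∘ suc) (x ∘ suc) w i j))
  (rotate (w i * w j) _ (+ x zero * (incidence ends zero i * incidence ends zero j)))
  where
  rotate : ∀ a b c → (a + b) + c ≡ a + (c + b)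
  rotate = solve-∀

-- `Joins` for a pair of variable vertices, where the equations can be matched with `refl`; eta for
-- pairs identifies it with `Joins` at `ends e`.
JoinedBy : ∀ {n} → Fin n × Fin n → Fin n → Fin n → Set
JoinedBy pq i j = pq ≡ (i , j) ⊎ pq ≡ (j , i)

incidence-product : ∀ {n} {p q i j : Fin n} → p ≢ q → i ≢ j →
  (joins? : Dec (JoinedBy (p , q) i j)) →
  (δ p i - δ q i) * (δ p j - δ q j) ≡ - + indicator joins?
incidence-product {p = p} {q} p≢q i≢j (yes (inj₁ refl)) =
  cong₂ _*_ (cong₂ _-_ (δ-refl p) (δ-≢ (p≢q ∘ sym))) (cong₂ _-_ (δ-≢ p≢q) (δ-refl q))
incidence-product {p = p} {q} p≢q i≢j (yes (inj₂ refl)) =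
  cong₂ _*_ (cong₂ _-_ (δ-≢ p≢q) (δ-refl q)) (cong₂ _-_ (δ-refl p) (δ-≢ (p≢q ∘ sym)))
incidence-product {p = p} {q} {i} {j} p≢q i≢j (no ¬joins) with p ≟ i | q ≟ i
... | yes refl | yes refl = contradiction refl p≢q
... | yes refl | no _     = cong ((1ℤ - 0ℤ) *_) (cong₂ _-_ (δ-≢ i≢j) (δ-≢ {i = q} {j} λ { refl → ¬joins (inj₁ refl) }))
... | no _     | yes refl = cong ((0ℤ - 1ℤ) *_) (cong₂ _-_ (δ-≢ {i = p} {j} λ { refl → ¬joins (inj₂ refl) }) (δ-≢ i≢j))
... | no _     | no _     = ℤₚ.*-zeroˡ (δ p j - δ q j)

diagonal-≡ : ∀ {n} {f g : Fin n → ℤ} i → (∀ j → i ≢ j → f j ≡ g j) → sum f ≡ sum g → f i ≡ g i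
diagonal-≡ {suc n} {f} {g} i f≡g sums = begin
  f i                                         ≡⟨ recover (f i) (sum (f ∘ punchIn i)) ⟩
  f i + sum (f ∘ punchIn i) - sum (f ∘ punchIn i) ≡⟨ cong₂ _-_
     (trans (sym (sum-remove {i = i} f)) (trans sums (sum-remove {i = i} g)))
     (sum-cong-≗ λ j → f≡g (punchIn i j) (punchInᵢ≢i i j ∘ sym)) ⟩
  g i + sum (g ∘ punchIn i) - sum (g ∘ punchIn i) ≡⟨ sym (recover (g i) (sum (g ∘ punchIn i))) ⟩
  g i                                         ∎
  where
  recover : ∀ a s → a ≡ a + s - s
  recover = solve-∀

∏-pos : ∀ {n} (r : Fin n → ℕ) → ∏ (λ i → + r i) ≡ + ∏ℕ r
∏-pos {zero}  r = refl
∏-pos {suc n} r = trans (cong (+ r zero *_) (∏-pos (r ∘ suc))) (sym (ℤₚ.pos-* (r zero) _))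

module _ {n} (G : Multigraph n) where
  open Multigraph G

  adjacency-sum : ∀ i j → + adjacency G i j ≡ sum (λ e → + indicator (joins? G e i j))
  adjacency-sum i j = trans (cong +_ (length-filter-tabulate (λ e → joins? G e i j) id))
    (pos-sum λ e → indicator (joins? G e i j))

  adjacency-sym : ∀ i j → adjacency G i j ≡ adjacency G j i
  adjacency-sym i j = cong length
    (filter-≐ {P = λ e → Joins G e i j} {Q = λ e → Joins G e j i} (λ e → joins? G e i j) (λ e → joins? G e j i) (swap , swap) (allFin #edges))

  diag-sym : ∀ (d : Fin n → ℤ) i j → diag d i j ≡ diag d j i
  diag-sym d i j with i ≟ j | j ≟ i
  ... | yes i≡j | yes _   = cong d i≡j
  ... | yes i≡j | no j≢i  = contradiction (sym i≡j) j≢i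
  ... | no i≢j  | yes j≡i = contradiction (sym j≡i) i≢j
  ... | no _    | no _    = refl

  arithmeticalLaplacian-sym : ∀ d i j → arithmeticalLaplacian G d i j ≡ arithmeticalLaplacian G d j i
  arithmeticalLaplacian-sym d i j = cong₂ (λ a b → a - + b) (diag-sym (+_ ∘ d) i j) (adjacency-sym i j)

module _ {n} (G : Multigraph n) (S : ArithmeticalStructure G) where
  open Multigraph G
  open ArithmeticalStructure S

  edgeWeight : Fin #edges → ℕ
  edgeWeight e = r (proj₁ (ends e)) ℕ.* r (proj₂ (ends e))

  private
    R : Fin n → ℤ
    R i = + r i

    L : Matrix n n
    L = arithmeticalLaplacian G d

    term : Fin #edges → Fin n → Fin n → ℤ
    term e i j = + edgeWeight e * (incidence ends e i * incidence ends e j)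

    weighted : ∀ {p q i j : Fin n} → p ≢ q → i ≢ j →
      (joins? : Dec (JoinedBy (p , q) i j)) →
      + (r p ℕ.* r q) * - + indicator joins? ≡ R i * R j * - + indicator joins?
    weighted {p} {q} p≢q i≢j (yes (inj₁ refl)) = cong (_* - 1ℤ) (ℤₚ.pos-* (r p) (r q))
    weighted {p} {q} p≢q i≢j (yes (inj₂ refl)) = cong (_* - 1ℤ) (trans (ℤₚ.pos-* (r p) (r q)) (ℤₚ.*-comm (R p) (R q)))
    weighted {p} {q} {i} {j} p≢q i≢j (no _) = trans (ℤₚ.*-zeroʳ (+ (r p ℕ.* r q))) (sym (ℤₚ.*-zeroʳ (R i * R j)))

    offDiagonal-≡ : ∀ i j → i ≢ j → R i * R j * L i j ≡ sum (λ e → term e i j)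
    offDiagonal-≡ i j i≢j = sym (begin
      sum (λ e → term e i j)
        ≡⟨ sum-cong-≗ (λ e → trans (cong (+ edgeWeight e *_) (incidence-product (loopless e) i≢j (joins? G e i j)))
             (weighted (loopless e) i≢j (joins? G e i j))) ⟩
      sum (λ e → R i * R j * - + indicator (joins? G e i j))
        ≡⟨ sym (*-distribˡ-sum (R i * R j) (λ e → - + indicator (joins? G e i j))) ⟩
      R i * R j * sum (λ e → - + indicator (joins? G e i j))
        ≡⟨ cong (R i * R j *_) (trans (sum-neg (λ e → + indicator (joins? G e i j)))
             (cong -_ (sym (adjacency-sum G i j)))) ⟩
      R i * R j * - + adjacency G i j
        ≡⟨ cong (R i * R j *_) (trans (sym (ℤₚ.+-identityˡ _)) (cong (λ z → z - + adjacency G i j)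
             (sym (cong (if_then + d i else 0ℤ) (dec-false (i ≟ j) i≢j))))) ⟩
      R i * R j * L i j ∎)

    rowSum-scaled : ∀ i → sum (λ j → R i * R j * L i j) ≡ 0ℤ
    rowSum-scaled i = begin
      sum (λ j → R i * R j * L i j)   ≡⟨ sum-cong-≗ (λ j → shuffle (R i) (R j) (L i j)) ⟩
      sum (λ j → R i * (L i j * R j)) ≡⟨ sym (*-distribˡ-sum (R i) (λ j → L i j * R j)) ⟩
      R i * (L *ᵥ R) i                ≡⟨ cong (R i *_) (balanced i) ⟩
      R i * 0ℤ                        ≡⟨ ℤₚ.*-zeroʳ (R i) ⟩
      0ℤ                              ∎
      where
      shuffle : ∀ a b l → a * b * l ≡ a * (l * b)
      shuffle = solve-∀

    sum-δ-1 : ∀ p → sum (δ {n} p) ≡ 1ℤ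
    sum-δ-1 p = trans (sum-cong-≗ λ i → sym (ℤₚ.*-identityʳ (δ p i))) (sum-δ (λ _ → 1ℤ) p)

    sum-incidence : ∀ e → sum (incidence ends e) ≡ 0ℤ
    sum-incidence e = begin
      sum (incidence ends e)              ≡⟨ ∑-distrib-+ (δ p) (λ i → - δ q i) ⟩
      sum (δ p) + sum (λ i → - δ q i)     ≡⟨ cong₂ _+_ (sum-δ-1 p) (trans (sum-neg (δ q)) (cong -_ (sum-δ-1 q))) ⟩
      0ℤ                                  ∎
      where
      p = proj₁ (ends e)
      q = proj₂ (ends e)

    rowSum-edges : ∀ i → sum (λ j → sum (λ e → term e i j)) ≡ 0ℤ
    rowSum-edges i = trans (∑-comm (λ j e → term e i j)) (sum-≡0 λ e → begin
      sum (λ j → term e i j)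
        ≡⟨ sum-cong-≗ (λ j → sym (ℤₚ.*-assoc (+ edgeWeight e) (incidence ends e i) (incidence ends e j))) ⟩
      sum (λ j → + edgeWeight e * incidence ends e i * incidence ends e j)
        ≡⟨ sym (*-distribˡ-sum (+ edgeWeight e * incidence ends e i) (incidence ends e)) ⟩
      + edgeWeight e * incidence ends e i * sum (incidence ends e)
        ≡⟨ cong (+ edgeWeight e * incidence ends e i *_) (sum-incidence e) ⟩
      + edgeWeight e * incidence ends e i * 0ℤ
        ≡⟨ ℤₚ.*-zeroʳ (+ edgeWeight e * incidence ends e i) ⟩
      0ℤ ∎)

    -- Off the diagonal both sides count the edges between `i` and `j`. The diagonal is not
    -- computed: all row sums vanish on both sides, on the left by `balanced`, on the right because
    -- incidence vectors sum to 0.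
    scaledLaplacian : ∀ i j → R i * R j * L i j ≡ sum (λ e → term e i j)
    scaledLaplacian i j = decide (i ≟ j)
      where
      decide : Dec (i ≡ j) → R i * R j * L i j ≡ sum (λ e → term e i j)
      decide (yes refl) = diagonal-≡ i (offDiagonal-≡ i) (trans (rowSum-scaled i) (sym (rowSum-edges i)))
      decide (no i≢j)   = offDiagonal-≡ i j i≢j

  scaledBordered : (Fin n → ℤ) → Matrix n n
  scaledBordered v i j = R i * R j * (L i j + v i * v j)

  scaled-bordered : ∀ v → scaledBordered v ≋ augmentedLaplacian ends edgeWeight (λ i → R i * v i)
  scaled-bordered v i j = begin
    R i * R j * (L i j + v i * v j)                    ≡⟨ distribute (R i) (R j) (L i j) (v i) (v j) ⟩
    (R i * v i) * (R j * v j) + R i * R j * L i j      ≡⟨ cong (λ z → (R i * v i) * (R j * v j) + z) (scaledLaplacian i j) ⟩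
    (R i * v i) * (R j * v j) + sum (λ e → term e i j) ≡⟨ sym (augmentedLaplacian-sum ends edgeWeight (λ i → R i * v i) i j) ⟩
    augmentedLaplacian ends edgeWeight (λ i → R i * v i) i j ∎
    where
    distribute : ∀ a b l x y → a * b * (l + x * y) ≡ (a * x) * (b * y) + a * b * l
    distribute = solve-∀

det-bordered-treeSum : ∀ {n} .{{_ : NonZero n}} (G : Multigraph n) (S : ArithmeticalStructure G) →
  let open ArithmeticalStructure S in
  ∀ v → (+_ ∘ r) · v ≡ 1ℤ →
  treeSum (Multigraph.ends G) (edgeWeight G S) ≡
  ∏ℕ r ℕ.* ∏ℕ r ℕ.* ∣ det (bordered (arithmeticalLaplacian G d) v) ∣
det-bordered-treeSum {n@(suc _)} G S v r·v≡1 = begin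
  τ                              ≡⟨ sym (cong ∣_∣ (ℤₚ.*-identityˡ (+ τ))) ⟩
  ∣ 1ℤ * + τ ∣                   ≡⟨ cong (λ s → ∣ s * s * + τ ∣) (sym r·v≡1) ⟩
  ∣ sum w * sum w * + τ ∣        ≡⟨ cong ∣_∣ (sym (det-augmentedLaplacian ends (edgeWeight G S) w)) ⟩
  ∣ det (augmentedLaplacian ends (edgeWeight G S) w) ∣ ≡⟨ cong ∣_∣ (sym (det-cong {A = scaledBordered G S v} (scaled-bordered G S v))) ⟩
  ∣ det (scaledBordered G S v) ∣ ≡⟨ cong ∣_∣ (det-scale (+_ ∘ r) (+_ ∘ r) N) ⟩
  ∣ ∏ (+_ ∘ r) * ∏ (+_ ∘ r) * det N ∣ ≡⟨ ℤₚ.abs-* (∏ (+_ ∘ r) * ∏ (+_ ∘ r)) (det N) ⟩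
  ∣ ∏ (+_ ∘ r) * ∏ (+_ ∘ r) ∣ ℕ.* ∣ det N ∣ ≡⟨ cong (ℕ._* ∣ det N ∣) (trans (ℤₚ.abs-* (∏ (+_ ∘ r)) (∏ (+_ ∘ r)))
       (cong (λ p → ∣ p ∣ ℕ.* ∣ p ∣) (∏-pos r))) ⟩
  ∏ℕ r ℕ.* ∏ℕ r ℕ.* ∣ det N ∣    ∎
  where
  open Multigraph G
  open ArithmeticalStructure S
  τ = treeSum ends (edgeWeight G S)
  w : Fin n → ℤ
  w i = + r i * v i
  N : Matrix n n
  N = bordered (arithmeticalLaplacian G d) v

-- Tree weights

∏ℕ-1 : ∀ {n} {f : Fin n → ℕ} → (∀ i → f i ≡ 1) → ∏ℕ f ≡ 1
∏ℕ-1 {n} f≡1 = trans (∏ℕ-cong f≡1) (∏ℕ-replicate-1 n)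

∏ℕ-single : ∀ {n} (r : Fin n → ℕ) p → ∏ℕ (λ i → if does (p ≟ i) then r i else 1) ≡ r p
∏ℕ-single {suc n} r p = begin
  ∏ℕ f                            ≡⟨ ∏ℕ-remove {i = p} f ⟩
  f p ℕ.* ∏ℕ (f ∘ punchIn p)      ≡⟨ cong₂ ℕ._*_ (cong (if_then r p else 1) (dec-true (p ≟ p) refl))
     (∏ℕ-1 λ k → cong (if_then r (punchIn p k) else 1) (dec-false (p ≟ punchIn p k) (punchInᵢ≢i p k ∘ sym))) ⟩
  r p ℕ.* 1                       ≡⟨ ℕₚ.*-identityʳ (r p) ⟩
  r p                             ∎
  where
  f : Fin (suc n) → ℕ
  f i = if does (p ≟ i) then r i else 1

^-sumℕ : ∀ {m} b (c : Fin m → ℕ) → b ℕ.^ sumℕ c ≡ ∏ℕ (λ e → b ℕ.^ c e)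
^-sumℕ {zero}  b c = refl
^-sumℕ {suc m} b c = trans (ℕₚ.^-distribˡ-+-* b (c zero) _) (cong (b ℕ.^ c zero ℕ.*_) (^-sumℕ b (c ∘ suc)))

edgeProduct-∏ℕ : ∀ {m} (x : Fin m → ℕ) T → edgeProduct x T ≡ ∏ℕ (λ e → if does (e ∈? T) then x e else 1)
edgeProduct-∏ℕ x []            = refl
edgeProduct-∏ℕ x (outside ∷ T) = trans (edgeProduct-∏ℕ (x ∘ suc) T) (sym (ℕₚ.*-identityˡ _))
edgeProduct-∏ℕ x (inside ∷ T)  = cong (x zero ℕ.*_) (edgeProduct-∏ℕ (x ∘ suc) T)

module _ {n} (G : Multigraph n) (r : Fin n → ℕ) where
  open Multigraph G

  incident⇔ : ∀ e i → Incident G e i ⇔ (proj₁ (ends e) ≡ i ⊎ proj₂ (ends e) ≡ i)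
  incident⇔ e i = mk⇔
    (λ { (w , inj₁ eq) → inj₁ (cong proj₁ eq) ; (w , inj₂ eq) → inj₂ (cong proj₂ eq) })
    (λ { (inj₁ refl) → _ , inj₁ refl ; (inj₂ refl) → _ , inj₂ refl })

  private
    ^-cases : ∀ {p q : Fin n} → p ≢ q → ∀ b i →
      b ℕ.^ indicator (p ≟ i ⊎-dec q ≟ i) ≡
      (if does (p ≟ i) then b else 1) ℕ.* (if does (q ≟ i) then b else 1)
    ^-cases {p} {q} p≢q b i with p ≟ i | q ≟ i
    ... | yes refl | yes refl = contradiction refl p≢q
    ... | yes _    | no _     = refl
    ... | no _     | yes _    = trans (ℕₚ.*-identityʳ b) (sym (ℕₚ.*-identityˡ b))
    ... | no _     | no _     = refl

  ∏ℕ-incident : ∀ e → ∏ℕ (λ i → r i ℕ.^ indicator (incident? G e i)) ≡ r (proj₁ (ends e)) ℕ.* r (proj₂ (ends e))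
  ∏ℕ-incident e = begin
    ∏ℕ (λ i → r i ℕ.^ indicator (incident? G e i))
      ≡⟨ ∏ℕ-cong (λ i → trans
           (cong (λ b → r i ℕ.^ (if b then 1 else 0)) (does-⇔ (incident⇔ e i) (incident? G e i) (p ≟ i ⊎-dec q ≟ i)))
           (^-cases (loopless e) (r i) i)) ⟩
    ∏ℕ (λ i → (if does (p ≟ i) then r i else 1) ℕ.* (if does (q ≟ i) then r i else 1))
      ≡⟨ ∏ℕ-distrib-* (λ i → if does (p ≟ i) then r i else 1) (λ i → if does (q ≟ i) then r i else 1) ⟩
    ∏ℕ (λ i → if does (p ≟ i) then r i else 1) ℕ.* ∏ℕ (λ i → if does (q ≟ i) then r i else 1)
      ≡⟨ cong₂ ℕ._*_ (∏ℕ-single r p) (∏ℕ-single r q) ⟩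
    r p ℕ.* r q ∎
    where
    p = proj₁ (ends e)
    q = proj₂ (ends e)

  degree-sum : ∀ T i → degree G T i ≡ sumℕ (λ e → indicator ((e ∈? T) ×-dec incident? G e i))
  degree-sum T i = length-filter-tabulate (λ e → (e ∈? T) ×-dec incident? G e i) id

  -- Double counting: with the degree written as a sum over edges, the products over vertices and
  -- edges can be exchanged. Each edge of `T` then contributes one factor at each of its two ends,
  -- which differ since there are no loops.
  ∏ℕ-degree : ∀ T → ∏ℕ (λ i → r i ℕ.^ degree G T i) ≡
                    edgeProduct (λ e → r (proj₁ (ends e)) ℕ.* r (proj₂ (ends e))) T
  ∏ℕ-degree T = begin
    ∏ℕ (λ i → r i ℕ.^ degree G T i)
      ≡⟨ ∏ℕ-cong (λ i → trans (cong (r i ℕ.^_) (degree-sum T i))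
           (^-sumℕ (r i) (λ e → indicator ((e ∈? T) ×-dec incident? G e i)))) ⟩
    ∏ℕ (λ i → ∏ℕ (λ e → r i ℕ.^ indicator ((e ∈? T) ×-dec incident? G e i)))
      ≡⟨ ∏ℕ-comm (λ i e → r i ℕ.^ indicator ((e ∈? T) ×-dec incident? G e i)) ⟩
    ∏ℕ (λ e → ∏ℕ (λ i → r i ℕ.^ indicator ((e ∈? T) ×-dec incident? G e i)))
      ≡⟨ ∏ℕ-cong (λ e → factor e (does (e ∈? T))) ⟩
    ∏ℕ (λ e → if does (e ∈? T) then x e else 1)
      ≡⟨ sym (edgeProduct-∏ℕ x T) ⟩
    edgeProduct x T ∎
    where
    x : Fin #edges → ℕ
    x e = r (proj₁ (ends e)) ℕ.* r (proj₂ (ends e))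

    -- Membership is replaced by a Boolean variable so that the decision of the conjunction
    -- computes.
    factor : ∀ e b → ∏ℕ (λ i → r i ℕ.^ (if b ∧ does (incident? G e i) then 1 else 0)) ≡ (if b then x e else 1)
    factor e true  = ∏ℕ-incident e
    factor e false = ∏ℕ-1 {n} λ _ → refl

-- Rational arithmetic and clearing of denominators

fromℕ : ℕ → ℚ
fromℕ n = + n / 1

-- Division by 1 is stuck on a gcd when `n` is a variable; in constructor form the operations of `ℚ`
-- compute.
fromℕ-mkℚ : ∀ n → fromℕ n ≡ mkℚ (+ n) 0 (coprime-sym (1-coprimeTo n))
fromℕ-mkℚ n = ℚₚ.normalize-coprime (coprime-sym (1-coprimeTo n))

fromℕ-+ : ∀ m n → fromℕ (m ℕ.+ n) ≡ fromℕ m ℚ.+ fromℕ n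
fromℕ-+ m n = sym (trans (cong₂ ℚ._+_ (fromℕ-mkℚ m) (fromℕ-mkℚ n))
  (cong (_/ 1) (trans (cong₂ ℤ._+_ (ℤₚ.*-identityʳ (+ m)) (ℤₚ.*-identityʳ (+ n))) (sym (ℤₚ.pos-+ m n)))))

fromℕ-* : ∀ m n → fromℕ (m ℕ.* n) ≡ fromℕ m ℚ.* fromℕ n
fromℕ-* m n = sym (trans (cong₂ ℚ._*_ (fromℕ-mkℚ m) (fromℕ-mkℚ n)) (cong (_/ 1) (sym (ℤₚ.pos-* m n))))

1/n*fromℕ : ∀ n .{{_ : NonZero n}} c → (+ 1 / n) ℚ.* fromℕ (n ℕ.* c) ≡ fromℕ c
1/n*fromℕ (suc k) c = ℚₚ.toℚᵘ-injective (begin-equality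
  toℚᵘ ((+ 1 / suc k) ℚ.* fromℕ (suc k ℕ.* c))
    ≃⟨ ℚₚ.toℚᵘ-homo-* (+ 1 / suc k) (fromℕ (suc k ℕ.* c)) ⟩
  toℚᵘ (+ 1 / suc k) ℚᵘ.* toℚᵘ (fromℕ (suc k ℕ.* c))
    ≃⟨ ℚᵘₚ.*-cong (ℚₚ.toℚᵘ-fromℚᵘ (ℚᵘ.mkℚᵘ (+ 1) k)) (ℚₚ.toℚᵘ-fromℚᵘ (ℚᵘ.mkℚᵘ (+ (suc k ℕ.* c)) 0)) ⟩
  ℚᵘ.mkℚᵘ (+ 1) k ℚᵘ.* ℚᵘ.mkℚᵘ (+ (suc k ℕ.* c)) 0
    ≃⟨ ℚᵘ.*≡* cross ⟩
  ℚᵘ.mkℚᵘ (+ c) 0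
    ≃⟨ ℚₚ.toℚᵘ-fromℚᵘ (ℚᵘ.mkℚᵘ (+ c) 0) ⟨
  toℚᵘ (fromℕ c) ∎ᵘ)
  where
  open ℚᵘₚ.≤-Reasoning renaming (_∎ to _∎ᵘ) using (begin-equality_; step-≃-⟩; step-≃-⟨)

  shuffle : ∀ s c → + 1 ℤ.* (s ℤ.* c) ℤ.* + 1 ≡ c ℤ.* (s ℤ.* + 1)
  shuffle = solve-∀

  cross : + 1 ℤ.* + (suc k ℕ.* c) ℤ.* + 1 ≡ + c ℤ.* + (suc k ℕ.* 1)
  cross = trans (cong (λ z → + 1 ℤ.* z ℤ.* + 1) (ℤₚ.pos-* (suc k) c))
    (trans (shuffle (+ suc k) (+ c)) (cong (+ c ℤ.*_) (sym (ℤₚ.pos-* (suc k) 1))))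

fromℕ-cancelʳ : ∀ n .{{_ : NonZero n}} {p q} → p ℚ.* fromℕ n ≡ q ℚ.* fromℕ n → p ≡ q
fromℕ-cancelʳ n {p} {q} eq = trans (sym (undo p)) (trans (cong (ℚ._* (+ 1 / n)) eq) (undo q))
  where
  undo : ∀ p → p ℚ.* fromℕ n ℚ.* (+ 1 / n) ≡ p
  undo p = begin
    p ℚ.* fromℕ n ℚ.* (+ 1 / n)       ≡⟨ ℚₚ.*-assoc p (fromℕ n) (+ 1 / n) ⟩
    p ℚ.* (fromℕ n ℚ.* (+ 1 / n))     ≡⟨ cong (p ℚ.*_) (ℚₚ.*-comm (fromℕ n) (+ 1 / n)) ⟩
    p ℚ.* ((+ 1 / n) ℚ.* fromℕ n)     ≡⟨ cong (λ m → p ℚ.* ((+ 1 / n) ℚ.* fromℕ m)) (sym (ℕₚ.*-identityʳ n)) ⟩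
    p ℚ.* ((+ 1 / n) ℚ.* fromℕ (n ℕ.* 1)) ≡⟨ cong (p ℚ.*_) (1/n*fromℕ n 1) ⟩
    p ℚ.* 1ℚ                          ≡⟨ ℚₚ.*-identityʳ p ⟩
    p                                 ∎

-- The exponent is -2, -1 or a natural number according to `d`, and its sign is visible to
-- computation only after this case split.
^ᶻ-clear : ∀ b .{{_ : NonZero b}} d → (b ^ᶻ (+ d ℤ.- + 2)) ℚ.* fromℕ (b ℕ.* b) ≡ fromℕ (b ℕ.^ d)
^ᶻ-clear b zero = trans (cong (λ c → (b ^ᶻ (+ 0 ℤ.- + 2)) ℚ.* fromℕ c) (square b)) (1/n*fromℕ (b ℕ.^ 2) {{ℕₚ.m^n≢0 b 2}} 1)
  where
  square : ∀ b → b ℕ.* b ≡ b ℕ.^ 2 ℕ.* 1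
  square b = trans (cong (b ℕ.*_) (sym (ℕₚ.*-identityʳ b))) (sym (ℕₚ.*-identityʳ _))
^ᶻ-clear b (suc zero) = trans (cong (λ c → (b ^ᶻ (+ 1 ℤ.- + 2)) ℚ.* fromℕ c) (square b))
  (trans (1/n*fromℕ (b ℕ.^ 1) {{ℕₚ.m^n≢0 b 1}} b) (cong fromℕ (sym (ℕₚ.*-identityʳ b))))
  where
  square : ∀ b → b ℕ.* b ≡ b ℕ.^ 1 ℕ.* b
  square b = cong (ℕ._* b) (sym (ℕₚ.*-identityʳ b))
^ᶻ-clear b (suc (suc k)) = trans (sym (fromℕ-* (b ℕ.^ k) (b ℕ.* b)))
  (cong fromℕ (trans (ℕₚ.*-comm (b ℕ.^ k) (b ℕ.* b)) (ℕₚ.*-assoc b b (b ℕ.^ k))))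

fromℕ-∏ℕ : ∀ {n} (f : Fin n → ℕ) → fromℕ (∏ℕ f) ≡ product (fromℕ ∘ f)
fromℕ-∏ℕ {zero}  f = refl
fromℕ-∏ℕ {suc n} f = trans (fromℕ-* (f zero) _) (cong (fromℕ (f zero) ℚ.*_) (fromℕ-∏ℕ (f ∘ suc)))

∏ℕ-nonZero : ∀ {n} (f : Fin n → ℕ) → (∀ i → NonZero (f i)) → NonZero (∏ℕ f)
∏ℕ-nonZero {zero}  f f≢0 = _
∏ℕ-nonZero {suc n} f f≢0 = ℕₚ.m*n≢0 (f zero) _ {{f≢0 zero}} {{∏ℕ-nonZero (f ∘ suc) (f≢0 ∘ suc)}}

module _ {n} (G : Multigraph n) (S : ArithmeticalStructure G) where
  open Multigraph G
  open ArithmeticalStructure S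

  treeWeight-clear : ∀ T → treeWeight G S T ℚ.* fromℕ (∏ℕ r ℕ.* ∏ℕ r) ≡ fromℕ (edgeProduct (edgeWeight G S) T)
  treeWeight-clear T = begin
    treeWeight G S T ℚ.* fromℕ (∏ℕ r ℕ.* ∏ℕ r)
      ≡⟨ cong (treeWeight G S T ℚ.*_) (trans (cong fromℕ (sym (∏ℕ-distrib-* r r))) (fromℕ-∏ℕ (λ i → r i ℕ.* r i))) ⟩
    treeWeight G S T ℚ.* product (λ i → fromℕ (r i ℕ.* r i))
      ≡⟨ sym (product-distrib-* (λ i → _^ᶻ_ (r i) {{r≢0 i}} (+ degree G T i ℤ.- + 2)) (λ i → fromℕ (r i ℕ.* r i))) ⟩
    product (λ i → (_^ᶻ_ (r i) {{r≢0 i}} (+ degree G T i ℤ.- + 2)) ℚ.* fromℕ (r i ℕ.* r i))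
      ≡⟨ product-cong (λ i → ^ᶻ-clear (r i) {{r≢0 i}} (degree G T i)) ⟩
    product (λ i → fromℕ (r i ℕ.^ degree G T i))
      ≡⟨ sym (fromℕ-∏ℕ (λ i → r i ℕ.^ degree G T i)) ⟩
    fromℕ (∏ℕ (λ i → r i ℕ.^ degree G T i))
      ≡⟨ cong fromℕ (∏ℕ-degree G r T) ⟩
    fromℕ (edgeProduct (edgeWeight G S) T) ∎

sumℚ-clear : ∀ {m} {P : Subset m → Set} (P? : ∀ T → Dec (P T)) (f : Subset m → ℚ) (g : Subset m → ℕ) c →
             (∀ T → f T ℚ.* fromℕ c ≡ fromℕ (g T)) →
             ∀ Ts → sumℚ (map f (filter P? Ts)) ℚ.* fromℕ c ≡ fromℕ (sumOver P? g Ts)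
sumℚ-clear P? f g c fc≡g [] = ℚₚ.*-zeroˡ (fromℕ c)
sumℚ-clear P? f g c fc≡g (T ∷ Ts) with does (P? T)
... | false = sumℚ-clear P? f g c fc≡g Ts
... | true  = trans (ℚₚ.*-distribʳ-+ (fromℕ c) (f T) _)
  (trans (cong₂ ℚ._+_ (fc≡g T) (sumℚ-clear P? f g c fc≡g Ts)) (sym (fromℕ-+ (g T) _)))

module _ {n} (G : Multigraph n) (S : ArithmeticalStructure G) where
  open Multigraph G
  open ArithmeticalStructure S

  sum-treeWeights : ∀ N τ c .{{_ : NonZero c}} → τ ≡ c ℕ.* N → c ≡ ∏ℕ r ℕ.* ∏ℕ r →
                    τ ≡ sumOver (isSpanningTree? G) (edgeProduct (edgeWeight G S)) (allSubsets #edges) →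
                    + N / 1 ≡ sumℚ (map (treeWeight G S) (spanningTrees G))
  sum-treeWeights N τ c τ≡cN c≡ τ≡sum = fromℕ-cancelʳ c (begin
    fromℕ N ℚ.* fromℕ c     ≡⟨ sym (fromℕ-* N c) ⟩
    fromℕ (N ℕ.* c)         ≡⟨ cong fromℕ (trans (ℕₚ.*-comm N c) (sym τ≡cN)) ⟩
    fromℕ τ                 ≡⟨ cong fromℕ τ≡sum ⟩
    fromℕ (sumOver (isSpanningTree? G) (edgeProduct (edgeWeight G S)) (allSubsets #edges))
      ≡⟨ sym (sumℚ-clear (isSpanningTree? G) (treeWeight G S) (edgeProduct (edgeWeight G S)) c
           (λ T → trans (cong (λ c → treeWeight G S T ℚ.* fromℕ c) c≡) (treeWeight-clear G S T)) (allSubsets #edges)) ⟩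
    sumℚ (map (treeWeight G S) (spanningTrees G)) ℚ.* fromℕ c ∎)

-- Nonsingularity and the conclusion

treeSum-positive : ∀ {n} .{{_ : NonZero n}} (G : Multigraph n) → Connected G ⊤ → (S : ArithmeticalStructure G) →
                   0 < treeSum (Multigraph.ends G) (edgeWeight G S)
treeSum-positive {suc _} G conn S = treeSum>0 ends (edgeWeight G S)
  (λ e → ℕ.>-nonZero⁻¹ (edgeWeight G S e) {{ℕₚ.m*n≢0 (r (proj₁ (ends e))) (r (proj₂ (ends e))) {{r≢0 _}} {{r≢0 _}}}})
  (connected⇒spans G conn)
  where
  open Multigraph G
  open ArithmeticalStructure S

module _ {n} .{{_ : NonZero n}} (G : Multigraph n) (S : ArithmeticalStructure G) (v : Fin n → ℤ)
         (r·v≡1 : (+_ ∘ ArithmeticalStructure.r S) · v ≡ 1ℤ) where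
  open Multigraph G
  open ArithmeticalStructure S

  private
    A : Matrix n n
    A = bordered (arithmeticalLaplacian G d) v

  criticalGroup-hasOrder : ∀ {N} → Transversal A N → HasOrder (criticalGroup G S) N
  criticalGroup-hasOrder = hasOrder (arithmeticalLaplacian G d) (arithmeticalLaplacian-sym G d) (+_ ∘ r) v balanced r·v≡1

  det-bordered≢0 : 0 < treeSum ends (edgeWeight G S) → det A ≢ 0ℤ
  det-bordered≢0 τ>0 detA≡0 = ℕₚ.<-irrefl (sym (trans (det-bordered-treeSum G S v r·v≡1)
    (trans (cong (λ x → ∏ℕ r ℕ.* ∏ℕ r ℕ.* ∣ x ∣) detA≡0) (ℕₚ.*-zeroʳ (∏ℕ r ℕ.* ∏ℕ r))))) τ>0

mainTheorem12 : ∀ {n : ℕ} (G : Multigraph n) → Connected G ⊤ → (S : ArithmeticalStructure G) →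
    ∃[ N ] (HasOrder (criticalGroup G S) N × + N / 1 ≡ sumℚ (map (treeWeight G S) (spanningTrees G)))
mainTheorem12 {n} G conn S =
  ∣ det N ∣ ,
  criticalGroup-hasOrder G S v r·v≡1
    (transversal N (det-bordered≢0 G S v r·v≡1 (treeSum-positive G conn S))) ,
  sum-treeWeights G S ∣ det N ∣ (treeSum ends (edgeWeight G S)) (P ℕ.* P) {{ℕₚ.m*n≢0 P P {{P≢0}} {{P≢0}}}}
    (det-bordered-treeSum G S v r·v≡1) refl
    (treeSum-⇔ ends (edgeWeight G S) (spanningTree⇔isTree G) (isSpanningTree? G))
  where
  open Multigraph G
  open ArithmeticalStructure S

  nonZero : ∀ {n} (r : Fin n → ℕ) → Vector.foldr gcd 0 r ≡ 1 → NonZero n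
  -- The empty family has gcd 0, so `gcd≡1` rules out `n = 0`.
  nonZero {suc n} r _ = _

  instance n≢0 = nonZero r gcd≡1

  P : ℕ
  P = ∏ℕ r

  P≢0 : NonZero P
  P≢0 = ∏ℕ-nonZero r r≢0

  v : Fin n → ℤ
  v = proj₁ (bézoutVector r)

  r·v≡1 : (+_ ∘ r) · v ≡ 1ℤ
  r·v≡1 = trans (proj₂ (bézoutVector r)) (cong +_ gcd≡1)

  N : Matrix n n
  N = bordered (arithmeticalLaplacian G d) v
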